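{- Let $t(n)$ denote the number of partitions $\lambda$ of $n$ such that $\mathcal{O}(\lambda)\equiv\mathcal{O}(\lambda')\pmod 4$, and let $u(n)=p(n)-t(n)$, where $p(n)$ is the number of partitions of $n$. Then, for $|q|<1$, \[ \sum_{n=0}^{\infty}u(n)q^n=\frac{2q^2(q^2;q^2)^2_{\infty}(q^8;q^8)^2_{\infty}(q^{32};q^{32})^2_{\infty}}{(q;q)_{\infty}(q^4;q^4)^5_{\infty}(q^{16};q^{16})_{\infty}}. \]
   Context: For a partition $\lambda$, $\lambda'$ denotes its conjugate partition and $\mathcal{O}(\lambda)$ denotes the number of odd parts of $\lambda$. For $|q|<1$, $(a;q)_\infty=\prod_{k\ge 0}(1-aq^k)$. Equivalently, $u(n)$ is the number of partitions $\lambda$ of $n$ with $\mathcal{O}(\lambda)\not\equiv\mathcal{O}(\lambda')\pmod 4$. -}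

module Defs where

open import Data.Nat as ℕ using (ℕ; zero; suc; _∸_; _⊔_; _≤?_; _≟_)
open import Data.Nat.Divisibility using (_∣?_)
open import Data.Integer as ℤ using (ℤ; +_; _-_)
open import Data.List using (List; []; _∷_; map; concatMap; upTo; filter; length; foldr)
open import Data.Bool using (Bool; true; false; if_then_else_)
open import Relation.Nullary using (¬?; does)
open import Relation.Nullary.Decidable using (⌊_⌋)

-- All compositions (ordered lists of positive parts) of n, using fuel f ≥ n.
-- The first part is suc k for k = 0 … n, the rest is a composition of n ∸ k.
compositionsF : ℕ → ℕ → List (List ℕ)
compositionsF _       zero    = [] ∷ []
compositionsF zero    (suc n) = []
compositionsF (suc f) (suc n) =
  concatMap (λ k → map (suc k ∷_) (compositionsF f (n ∸ k))) (upTo (suc n))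

compositions : ℕ → List (List ℕ)
compositions n = compositionsF n n

nonIncreasing : List ℕ → Bool
nonIncreasing []           = true
nonIncreasing (x ∷ [])     = true
nonIncreasing (x ∷ y ∷ xs) = ⌊ y ≤? x ⌋ Data.Bool.∧ nonIncreasing (y ∷ xs)
  where import Data.Bool

partitions : ℕ → List (List ℕ)
partitions n = filter (λ l → nonIncreasing l Data.Bool.≟ true) (compositions n)
  where import Data.Bool

largest : List ℕ → ℕ
largest = foldr _⊔_ 0

conjugate : List ℕ → List ℕ
conjugate λs = map (λ j → length (filter (λ x → suc j ≤? x) λs)) (upTo (largest λs))

oddParts : List ℕ → ℕ
oddParts λs = length (filter (λ x → x ℕ.% 2 ≟ 1) λs)

sameMod4 : List ℕ → Bool
sameMod4 λs = ⌊ oddParts λs ℕ.% 4 ≟ oddParts (conjugate λs) ℕ.% 4 ⌋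

p : ℕ → ℕ
p n = length (partitions n)

t : ℕ → ℕ
t n = length (filter (λ l → sameMod4 l Data.Bool.≟ true) (partitions n))
  where import Data.Bool

u : ℕ → ℤ
u n = + p n - + t n

Series : Set
Series = ℕ → ℤ

one : Series
one zero    = + 1
one (suc _) = + 0

_⊛_ : Series → Series → Series
(f ⊛ g) n = foldr ℤ._+_ (+ 0) (map (λ k → f k ℤ.* g (n ∸ k)) (upTo (suc n)))
infixl 7 _⊛_

_^ˢ_ : Series → ℕ → Series
f ^ˢ zero  = one
f ^ˢ suc k = f ⊛ (f ^ˢ k)

scale : ℤ → Series → Series
scale c f n = c ℤ.* f n

shift : ℕ → Series → Series
shift m f n = if ⌊ m ≤? n ⌋ then f (n ∸ m) else + 0

prodUpTo : (ℕ → Series) → ℕ → Series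
prodUpTo s zero    = one
prodUpTo s (suc K) = prodUpTo s K ⊛ s (suc K)

-- Infinite product ∏_{k≥1} s k, for factors with s k ≡ 1 (mod q^k):
-- the coefficient of q^n is already determined by the first n factors.
infProd : (ℕ → Series) → Series
infProd s n = prodUpTo s n n

oneMinusX^ : ℕ → Series
oneMinusX^ m n = one n - (if ⌊ n ≟ m ⌋ then + 1 else + 0)

-- 1/(1 - q^m) = Σ_j q^{mj}
geom : ℕ → Series
geom m n = if ⌊ m ∣? n ⌋ then + 1 else + 0

qPoch : ℕ → Series
qPoch a = infProd (λ k → oneMinusX^ (a ℕ.* k))

qPochInv : ℕ → Series
qPochInv a = infProd (λ k → geom (a ℕ.* k))

uSeries : Series
uSeries = u

{-# OPTIONS --safe #-}

-- Let F = Σ (-1)^((O(λ) - O(λ′)) / 2) q^|λ|, so that 2 Σ u(n) qⁿ = 1/(q; q) - F.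
-- Removing the largest part N of λ replaces O(λ′) by N - O(λ′); hence the series F_N
-- of partitions with parts ≤ N satisfy F_N(q) = F_{N-1}(q) ± q^N F_N(-q). In
-- its solution, F_{2N} · (-q²; q⁴)_N is the coefficient of z^N in
--   ∏_{k ≥ 0} (1 + z q^{2k+1}) / (1 - (-1)^k z q^{2k}),
-- and N → ∞ gives the product F = (-q; q²) / ((q⁴; q⁴) (-q²; q⁴)²).
-- With x = q² this says F (q; q) = φ(-x)/φ(x), so 2 (q; q) Σ u(n) qⁿ is
-- (φ(x) - φ(-x))/φ(x), and φ(x) - φ(-x) = 4x ψ(x⁸) because the even squares cancel.
-- The series φ and ψ are turned into products by Shanks's finite identity.
-- All of this takes place in ℤ⟦q⟧/(qᴹ), where q is nilpotent and limits are equalities.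
module Submission where

open import Defs
open import Algebra.Bundles using (CommutativeRing)
open import Algebra.Solver.Ring.AlmostCommutativeRing using (fromCommutativeRing; _-Raw-AlmostCommutative⟶_)
open import Data.Bool using (true; false; if_then_else_; _∧_)
import Data.Bool as Bool
open import Data.Integer as ℤ using (ℤ; +_; -[1+_]; _⊖_)
import Data.Integer.Properties as ℤₚ
import Data.Integer.Tactic.RingSolver as ℤ-Solver
open import Data.List using (List; []; _∷_; _++_; map; concatMap; upTo; applyUpTo; filter; length; foldr)
open import Data.List.Properties using (map-upTo; filter-accept; filter-reject)
open import Data.List.Relation.Unary.All as All using (All; []; _∷_)
import Data.List.Relation.Unary.All.Properties as Allₚ
open import Data.Maybe using (Maybe; just; nothing)
open import Data.Nat as ℕ using (ℕ; zero; suc; _∸_; _⊔_; _≤_; _<_; z≤n; s≤s; _≤?_; _≟_; ⌊_/2⌋)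
open import Data.Nat.Divisibility using (_∣_; _∣?_; ∣⇒≤; ∣-refl; ∣m+n∣m⇒∣n; ∣m∣n⇒∣m+n; _∣0)
import Data.Nat.DivMod as DivMod
open import Data.Nat.ListAction using (sum)
import Data.Nat.Properties as ℕₚ
import Data.Nat.Tactic.RingSolver as ℕ-Solver
open import Data.Product using (_×_; _,_; proj₁; proj₂; Σ)
open import Function using (_∘_; id)
open import Relation.Binary.PropositionalEquality as ≡ using (_≡_; _≢_)
open import Relation.Nullary using (yes; no; ¬_; contradiction)
open import Relation.Nullary.Decidable using (⌊_⌋)

-- The recurrence for F_N is implicit and involves F_N(-q), while an abstract ring has no
-- substitution q ↦ -q. Every family therefore comes with a companion that plays the part of its
-- value at -q, and each recurrence becomes a linear system in two unknowns. For the part sizes 2N +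
-- 1 and 2N + 2 the determinants are 1 + s² and 1 - ε², where s = q(-q²)^N and ε = (-q²)^(N+1). The
-- coefficients of z^N satisfy a one-step system with the same ε, so 1 - ε² occurs on both sides and
-- cancels as a unit, whereas the factors 1 + s² accumulate to (-q²; q⁴)_N.
--
-- The passage N → ∞ is Abel's lemma in algebraic form: 1/(1 - z), the factor with k = 0, is the
-- only one whose denominator involves no power of the nilpotent q, so the coefficient of z^N is
-- eventually the value at z = 1 of the product without this denominator.

-- Normalisation in commutative rings with integer coefficients

module IntegerCoefficients {c ℓ} (R : CommutativeRing c ℓ) where

  open CommutativeRing R
  open import Algebra.Properties.Ring ring using (-‿distribˡ-*; -‿involutive; -0#≈0#)
  open import Algebra.Properties.AbelianGroup +-abelianGroup using (⁻¹-∙-comm)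
  open import Algebra.Properties.Semiring.Mult.TCOptimised semiring using (×-homo-+; ×1-homo-*; 1+×) renaming (_×_ to _·_)
  open import Relation.Binary.Reasoning.Setoid setoid

  -- With the optimised multiple, `fromℤ (+ 1)`, `fromℤ (+ 2)` and `fromℤ (+ 4)` compute to `1#`,
  -- `1# + 1#` and `1# + 1# + 1# + 1#`, so `con` matches these constants as they are written in the
  -- goals.
  fromℤ : ℤ → Carrier
  fromℤ (+ n)    = n · 1#
  fromℤ -[1+ n ] = - (suc n · 1#)

  fromℤ-neg : ∀ i → fromℤ (ℤ.- i) ≈ - fromℤ i
  fromℤ-neg (+ zero)  = sym -0#≈0#
  fromℤ-neg (+ suc n) = refl
  fromℤ-neg -[1+ n ]  = sym (-‿involutive _)

  cancel-common : ∀ a b → a - b ≈ (1# + a) - (1# + b)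
  cancel-common a b = begin
    a - b                          ≈⟨ +-identityˡ _ ⟨
    0# + (a - b)                   ≈⟨ +-congʳ (-‿inverseʳ 1#) ⟨
    (1# - 1#) + (a - b)            ≈⟨ +-assoc _ _ _ ⟩
    1# + (- 1# + (a - b))          ≈⟨ +-congˡ (+-assoc _ _ _) ⟨
    1# + ((- 1# + a) - b)          ≈⟨ +-congˡ (+-congʳ (+-comm _ _)) ⟩
    1# + ((a - 1#) - b)            ≈⟨ +-congˡ (+-assoc _ _ _) ⟩
    1# + (a + (- 1# - b))          ≈⟨ +-assoc _ _ _ ⟨
    (1# + a) + (- 1# - b)          ≈⟨ +-congˡ (⁻¹-∙-comm 1# b) ⟩
    (1# + a) - (1# + b)            ∎

  fromℤ-⊖ : ∀ m n → fromℤ (m ⊖ n) ≈ m · 1# - n · 1#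
  fromℤ-⊖ zero    zero    = sym (-‿inverseʳ 0#)
  fromℤ-⊖ zero    (suc n) = sym (+-identityˡ _)
  fromℤ-⊖ (suc m) zero    = sym (trans (+-congˡ -0#≈0#) (+-identityʳ _))
  fromℤ-⊖ (suc m) (suc n) = begin
    fromℤ (suc m ⊖ suc n)              ≡⟨ ≡.cong fromℤ (ℤₚ.[1+m]⊖[1+n]≡m⊖n m n) ⟩
    fromℤ (m ⊖ n)                      ≈⟨ fromℤ-⊖ m n ⟩
    m · 1# - n · 1#                    ≈⟨ cancel-common _ _ ⟩
    (1# + m · 1#) - (1# + n · 1#)      ≈⟨ +-cong (1+× m 1#) (-‿cong (1+× n 1#)) ⟨
    suc m · 1# - suc n · 1#            ∎

  fromℤ-+ : ∀ i j → fromℤ (i ℤ.+ j) ≈ fromℤ i + fromℤ j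
  fromℤ-+ (+ m)    (+ n)    = ×-homo-+ 1# m n
  fromℤ-+ (+ m)    -[1+ n ] = fromℤ-⊖ m (suc n)
  fromℤ-+ -[1+ m ] (+ n)    = trans (fromℤ-⊖ n (suc m)) (+-comm _ _)
  fromℤ-+ -[1+ m ] -[1+ n ] = begin
    - (suc (suc (m ℕ.+ n)) · 1#)       ≡⟨ ≡.cong (λ k → - (suc k · 1#)) (≡.sym (ℕₚ.+-suc m n)) ⟩
    - ((suc m ℕ.+ suc n) · 1#)         ≈⟨ -‿cong (×-homo-+ 1# (suc m) (suc n)) ⟩
    - (suc m · 1# + suc n · 1#)        ≈⟨ ⁻¹-∙-comm _ _ ⟨
    - (suc m · 1#) - (suc n · 1#)      ∎

  fromℤ-pos-* : ∀ m j → fromℤ (+ m ℤ.* j) ≈ fromℤ (+ m) * fromℤ j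
  fromℤ-pos-* m (+ n)    = trans (reflexive (≡.cong fromℤ (≡.sym (ℤₚ.pos-* m n)))) (×1-homo-* m n)
  fromℤ-pos-* m -[1+ n ] = begin
    fromℤ (+ m ℤ.* -[1+ n ])           ≡⟨ ≡.cong fromℤ (≡.sym (ℤₚ.neg-distribʳ-* (+ m) (+ suc n))) ⟩
    fromℤ (ℤ.- (+ m ℤ.* + suc n))      ≈⟨ fromℤ-neg (+ m ℤ.* + suc n) ⟩
    - fromℤ (+ m ℤ.* + suc n)          ≈⟨ -‿cong (fromℤ-pos-* m (+ suc n)) ⟩
    - (fromℤ (+ m) * fromℤ (+ suc n))  ≈⟨ -‿distribʳ-* _ _ ⟩
    fromℤ (+ m) * - fromℤ (+ suc n)    ∎
    where open import Algebra.Properties.Ring ring using (-‿distribʳ-*)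

  fromℤ-* : ∀ i j → fromℤ (i ℤ.* j) ≈ fromℤ i * fromℤ j
  fromℤ-* (+ m)    j = fromℤ-pos-* m j
  fromℤ-* -[1+ m ] j = begin
    fromℤ (-[1+ m ] ℤ.* j)             ≡⟨ ≡.cong fromℤ (≡.sym (ℤₚ.neg-distribˡ-* (+ suc m) j)) ⟩
    fromℤ (ℤ.- (+ suc m ℤ.* j))        ≈⟨ fromℤ-neg (+ suc m ℤ.* j) ⟩
    - fromℤ (+ suc m ℤ.* j)            ≈⟨ -‿cong (fromℤ-pos-* (suc m) j) ⟩
    - (fromℤ (+ suc m) * fromℤ j)      ≈⟨ -‿distribˡ-* _ _ ⟩
    - fromℤ (+ suc m) * fromℤ j        ∎

  homomorphism : ℤ.+-*-rawRing -Raw-AlmostCommutative⟶ fromCommutativeRing R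
  homomorphism = record
    { ⟦_⟧    = fromℤ
    ; +-homo = fromℤ-+
    ; *-homo = fromℤ-*
    ; -‿homo = fromℤ-neg
    ; 0-homo = refl
    ; 1-homo = refl
    }

  coefficient-equality : ∀ i j → Maybe (fromℤ i ≈ fromℤ j)
  coefficient-equality i j with i ℤ.≟ j
  ... | yes i≡j = just (reflexive (≡.cong fromℤ i≡j))
  ... | no  _   = nothing

  open import Algebra.Solver.Ring ℤ.+-*-rawRing (fromCommutativeRing R) homomorphism coefficient-equality public
    using (solve; _:=_; con; _:+_; _:*_; :-_; _:-_)

-- Units, nilpotent elements, q-shifted factorials and Shanks's identity

module Products {c ℓ} (R : CommutativeRing c ℓ) where

  open CommutativeRing R public hiding (zero)
  open import Algebra.Properties.Semiring.Exp semiring public using (_^_; ^-congˡ; ^-congʳ; ^-homo-*; ^-assocʳ)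
  open import Algebra.Properties.CommutativeSemiring.Exp commutativeSemiring public using (^-distrib-*)
  open IntegerCoefficients R public using (solve; _:=_; con; _:+_; _:*_; :-_; _:-_)
  open import Relation.Binary.Reasoning.Setoid setoid

  -- These three are stated over an abstract ring because in the concrete ring of
  -- series the solver would unfold the convolutions.
  [1-x]*g≈g-x*g : ∀ x g → (1# - x) * g ≈ g - x * g
  [1-x]*g≈g-x*g = solve 2 (λ x g → (con (+ 1) :- x) :* g := g :- x :* g) refl

  c*[e*[1-x]]≈[c-x*c]*e : ∀ c e x → c * (e * (1# - x)) ≈ (c - x * c) * e
  c*[e*[1-x]]≈[c-x*c]*e = solve 3 (λ c e x → c :* (e :* (con (+ 1) :- x)) := (c :- x :* c) :* e) refl

  -[x*x]*w*f≈-[x*[x*[w*f]]] : ∀ x w f → - (x * x) * w * f ≈ - (x * (x * (w * f)))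
  -[x*x]*w*f≈-[x*[x*[w*f]]] = solve 3 (λ x w f → :- (x :* x) :* w :* f := :- (x :* (x :* (w :* f)))) refl

  Unit : Carrier → Set _
  Unit u = Σ Carrier λ v → u * v ≈ 1#

  unit-* : ∀ {u v} → Unit u → Unit v → Unit (u * v)
  unit-* {u} {v} (u⁻¹ , hu) (v⁻¹ , hv) = u⁻¹ * v⁻¹ , (begin
    u * v * (u⁻¹ * v⁻¹)      ≈⟨ solve 4 (λ a b c d → a :* b :* (c :* d) := (a :* c) :* (b :* d)) refl u v u⁻¹ v⁻¹ ⟩
    (u * u⁻¹) * (v * v⁻¹)    ≈⟨ *-cong hu hv ⟩
    1# * 1#                  ≈⟨ *-identityˡ 1# ⟩
    1#                       ∎)

  unit-cancelʳ : ∀ {u a b} → Unit u → a * u ≈ b * u → a ≈ b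
  unit-cancelʳ {u} {a} {b} (v , uv≈1) au≈bu = begin
    a              ≈⟨ *-identityʳ a ⟨
    a * 1#         ≈⟨ *-congˡ uv≈1 ⟨
    a * (u * v)    ≈⟨ *-assoc a u v ⟨
    a * u * v      ≈⟨ *-congʳ au≈bu ⟩
    b * u * v      ≈⟨ *-assoc b u v ⟩
    b * (u * v)    ≈⟨ *-congˡ uv≈1 ⟩
    b * 1#         ≈⟨ *-identityʳ b ⟩
    b              ∎

  Nilpotent : Carrier → Set _
  Nilpotent x = Σ ℕ λ n → x ^ n ≈ 0#

  ^-zero-mono : ∀ {x m n} → m ℕ.≤ n → x ^ m ≈ 0# → x ^ n ≈ 0#
  ^-zero-mono {x} {m} {n} m≤n x^m≈0 = begin
    x ^ n                      ≡⟨ ≡.cong (x ^_) (≡.sym (ℕₚ.m+[n∸m]≡n m≤n)) ⟩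
    x ^ (m ℕ.+ (n ℕ.∸ m))      ≈⟨ ^-homo-* x m (n ℕ.∸ m) ⟩
    x ^ m * x ^ (n ℕ.∸ m)      ≈⟨ *-congʳ x^m≈0 ⟩
    0# * x ^ (n ℕ.∸ m)         ≈⟨ zeroˡ _ ⟩
    0#                         ∎

  *-^-zero : ∀ x a n → x ^ n ≈ 0# → (x * a) ^ n ≈ 0#
  *-^-zero x a n x^n≈0 = trans (^-distrib-* x a n) (trans (*-congʳ x^n≈0) (zeroˡ _))

  neg-^-zero : ∀ x n → x ^ n ≈ 0# → (- x) ^ n ≈ 0#
  neg-^-zero x n x^n≈0 = trans (^-congˡ n (solve 1 (λ x → :- x := x :* :- con (+ 1)) refl x)) (*-^-zero x (- 1#) n x^n≈0)

  *-nilpotent : ∀ {x} a → Nilpotent x → Nilpotent (x * a)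
  *-nilpotent {x} a (n , x^n≈0) = n , *-^-zero x a n x^n≈0

  geometric : Carrier → ℕ → Carrier
  geometric x zero    = 0#
  geometric x (suc n) = geometric x n + x ^ n

  geometric-sum : ∀ x n → (1# - x) * geometric x n ≈ 1# - x ^ n
  geometric-sum x zero    = solve 1 (λ x → (con (+ 1) :- x) :* con (+ 0) := con (+ 1) :- con (+ 1)) refl x
  geometric-sum x (suc n) = begin
    (1# - x) * (geometric x n + x ^ n)             ≈⟨ distribˡ _ _ _ ⟩
    (1# - x) * geometric x n + (1# - x) * x ^ n    ≈⟨ +-congʳ (geometric-sum x n) ⟩
    (1# - x ^ n) + (1# - x) * x ^ n                ≈⟨ solve 2 (λ x y → (con (+ 1) :- y) :+ (con (+ 1) :- x) :* y := con (+ 1) :- x :* y) refl x (x ^ n) ⟩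
    1# - x * x ^ n                                 ∎

  1-nilpotent-unit : ∀ {x} → Nilpotent x → Unit (1# - x)
  1-nilpotent-unit {x} (n , x^n≈0) = geometric x n , (begin
    (1# - x) * geometric x n   ≈⟨ geometric-sum x n ⟩
    1# - x ^ n                 ≈⟨ +-congˡ (-‿cong x^n≈0) ⟩
    1# - 0#                    ≈⟨ solve 0 (con (+ 1) :- con (+ 0) := con (+ 1)) refl ⟩
    1#                         ∎)

  ∏ : (ℕ → Carrier) → ℕ → Carrier
  ∏ f zero    = 1#
  ∏ f (suc n) = ∏ f n * f n

  ∑ : (ℕ → Carrier) → ℕ → Carrier
  ∑ f zero    = 0#
  ∑ f (suc n) = ∑ f n + f n

  ∏-cong : ∀ {f g} → (∀ i → f i ≈ g i) → ∀ n → ∏ f n ≈ ∏ g n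
  ∏-cong f≈g zero    = refl
  ∏-cong f≈g (suc n) = *-cong (∏-cong f≈g n) (f≈g n)

  ∏-* : ∀ f g n → ∏ (λ i → f i * g i) n ≈ ∏ f n * ∏ g n
  ∏-* f g zero    = sym (*-identityˡ 1#)
  ∏-* f g (suc n) = begin
    ∏ (λ i → f i * g i) n * (f n * g n)    ≈⟨ *-congʳ (∏-* f g n) ⟩
    ∏ f n * ∏ g n * (f n * g n)            ≈⟨ solve 4 (λ a b c d → a :* b :* (c :* d) := a :* c :* (b :* d)) refl (∏ f n) (∏ g n) (f n) (g n) ⟩
    ∏ f n * f n * (∏ g n * g n)            ∎

  ∏-unit : ∀ {f} → (∀ i → Unit (f i)) → ∀ n → Unit (∏ f n)
  ∏-unit uf zero    = 1# , *-identityˡ 1#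
  ∏-unit uf (suc n) = unit-* (∏-unit uf n) (uf n)

  ∏-1 : ∀ n → ∏ (λ _ → 1#) n ≈ 1#
  ∏-1 zero    = refl
  ∏-1 (suc n) = trans (*-identityʳ _) (∏-1 n)

  ∏-inverse : ∀ {f g} → (∀ i → f i * g i ≈ 1#) → ∀ n → ∏ f n * ∏ g n ≈ 1#
  ∏-inverse {f} {g} fg≈1 n = trans (sym (∏-* f g n)) (trans (∏-cong fg≈1 n) (∏-1 n))

  -- The q-shifted factorial (a; p)ₙ.
  poch : Carrier → Carrier → ℕ → Carrier
  poch a p = ∏ (λ i → 1# - a * p ^ i)

  poch-cong : ∀ {a b p r} → a ≈ b → p ≈ r → ∀ n → poch a p n ≈ poch b r n
  poch-cong a≈b p≈r = ∏-cong (λ i → +-congˡ (-‿cong (*-cong a≈b (^-congˡ i p≈r))))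

  poch-unit : ∀ {a p} → Nilpotent a → ∀ n → Unit (poch a p n)
  poch-unit {a} {p} nil-a = ∏-unit (λ i → 1-nilpotent-unit (*-nilpotent (p ^ i) nil-a))

  -- All factors from index m on equal 1. This takes the place of convergence: `poch a p m` is the
  -- infinite product (a; p).
  poch-stable : ∀ a {p m} → p ^ m ≈ 0# → ∀ n → m ℕ.≤ n → poch a p n ≈ poch a p m
  poch-stable a {p} {m} p^m≈0 n m≤n = begin
    poch a p n                    ≡⟨ ≡.cong (poch a p) (≡.sym (≡.trans (ℕₚ.+-comm (n ℕ.∸ m) m) (ℕₚ.m+[n∸m]≡n m≤n))) ⟩
    poch a p ((n ℕ.∸ m) ℕ.+ m)    ≈⟨ extend (n ℕ.∸ m) ⟩
    poch a p m                    ∎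
    where
    extend : ∀ k → poch a p (k ℕ.+ m) ≈ poch a p m
    extend zero    = refl
    extend (suc k) = begin
      poch a p (k ℕ.+ m) * (1# - a * p ^ (k ℕ.+ m))    ≈⟨ *-cong (extend k) (+-congˡ (-‿cong (*-congˡ (^-zero-mono (ℕₚ.m≤n+m m k) p^m≈0)))) ⟩
      poch a p m * (1# - a * 0#)                       ≈⟨ solve 2 (λ a u → u :* (con (+ 1) :- a :* con (+ 0)) := u) refl a (poch a p m) ⟩
      poch a p m                                       ∎

  ∑-telescope : ∀ {f g : ℕ → Carrier} → (∀ s → f s ≈ g (suc s) - g s) → ∀ n → ∑ f n ≈ g n - g 0
  ∑-telescope {f} {g} h zero    = sym (-‿inverseʳ (g 0))
  ∑-telescope {f} {g} h (suc n) = begin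
    ∑ f n + f n                          ≈⟨ +-cong (∑-telescope h n) (h n) ⟩
    (g n - g 0) + (g (suc n) - g n)      ≈⟨ solve 3 (λ a b c → (a :- b) :+ (c :- a) := c :- b) refl (g n) (g 0) (g (suc n)) ⟩
    g (suc n) - g 0                      ∎

  ∑-difference : ∀ f g n → ∑ (λ s → f s - g s) n ≈ ∑ f n - ∑ g n
  ∑-difference f g zero    = sym (-‿inverseʳ 0#)
  ∑-difference f g (suc n) = begin
    ∑ (λ s → f s - g s) n + (f n - g n)    ≈⟨ +-congʳ (∑-difference f g n) ⟩
    (∑ f n - ∑ g n) + (f n - g n)          ≈⟨ solve 4 (λ a b c d → (a :- b) :+ (c :- d) := (a :+ c) :- (b :+ d)) refl (∑ f n) (∑ g n) (f n) (g n) ⟩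
    (∑ f n + f n) - (∑ g n + g n)          ∎

  -- With p = ab and
  --   τ n s = (p; p)ₙ / (b; p)ₙ · (a; p)ₛ / (p; p)ₛ · (b pⁿ)ˢ,
  -- the difference τ (n + 1) s - τ n s telescopes in s, so the partial sums
  -- Σ_{s ≤ n} τ n s have an explicit increment (`term`), while modulo pⁿ only the
  -- summand s = 0 survives. This is Shanks's proof of Gauss's two theta identities.
  module Shanks {a b p : Carrier} (ab≈p : a * b ≈ p) (nil-p : Nilpotent p) (nil-b : Nilpotent b) where

    α-unit : ∀ i → Unit (1# - p * p ^ i)
    α-unit i = 1-nilpotent-unit (*-nilpotent (p ^ i) nil-p)

    β-unit : ∀ i → Unit (1# - b * p ^ i)
    β-unit i = 1-nilpotent-unit (*-nilpotent (p ^ i) nil-b)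

    α⁻¹ β⁻¹ A⁻¹ B⁻¹ ρ : ℕ → Carrier
    α⁻¹ i = proj₁ (α-unit i)
    β⁻¹ i = proj₁ (β-unit i)
    A⁻¹ = ∏ α⁻¹
    B⁻¹ = ∏ β⁻¹
    ρ n = B⁻¹ n * poch a p n

    τ : ℕ → ℕ → Carrier
    τ n s = poch p p n * B⁻¹ n * (poch a p s * A⁻¹ s) * (b * p ^ n) ^ s

    τ-suc-n : ∀ n s → τ (suc n) s ≈ τ n s * (p ^ s * (1# - p * p ^ n) * β⁻¹ n)
    τ-suc-n n s = begin
      P * α * (B⁻¹ n * β⁻¹ n) * C * (b * (p * p ^ n)) ^ s    ≈⟨ *-congˡ (^-congˡ s (solve 3 (λ b p r → b :* (p :* r) := p :* (b :* r)) refl b p (p ^ n))) ⟩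
      P * α * (B⁻¹ n * β⁻¹ n) * C * (p * (b * p ^ n)) ^ s    ≈⟨ *-congˡ (^-distrib-* p (b * p ^ n) s) ⟩
      P * α * (B⁻¹ n * β⁻¹ n) * C * (p ^ s * (b * p ^ n) ^ s) ≈⟨ solve 7 (λ P α B⁻¹ β⁻¹ C x y → P :* α :* (B⁻¹ :* β⁻¹) :* C :* (x :* y) := P :* B⁻¹ :* C :* y :* (x :* α :* β⁻¹)) refl P α (B⁻¹ n) (β⁻¹ n) C (p ^ s) ((b * p ^ n) ^ s) ⟩
      τ n s * (p ^ s * α * β⁻¹ n)                          ∎
      where
      P = poch p p n
      α = 1# - p * p ^ n
      C = poch a p s * A⁻¹ s

    τ-suc-s : ∀ n s → τ n (suc s) * (1# - p * p ^ s) ≈ τ n s * ((1# - a * p ^ s) * (b * p ^ n))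
    τ-suc-s n s = begin
      PV * (A * a′ * (A⁻¹ s * α⁻¹ s)) * (z * z ^ s) * α       ≈⟨ solve 8 (λ PV A a′ A⁻¹ α⁻¹ z y α → PV :* (A :* a′ :* (A⁻¹ :* α⁻¹)) :* (z :* y) :* α := PV :* (A :* A⁻¹) :* y :* (a′ :* z) :* (α :* α⁻¹)) refl PV A a′ (A⁻¹ s) (α⁻¹ s) z (z ^ s) α ⟩
      τ n s * (a′ * z) * (α * α⁻¹ s)                        ≈⟨ *-congˡ (proj₂ (α-unit s)) ⟩
      τ n s * (a′ * z) * 1#                               ≈⟨ *-identityʳ _ ⟩
      τ n s * (a′ * z)                                    ∎
      where
      PV = poch p p n * B⁻¹ n
      A = poch a p s
      a′ = 1# - a * p ^ s
      α = 1# - p * p ^ s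
      z = b * p ^ n

    -- With x = pˢ and y = pⁿ all rests on x(1 - py) - (1 - by) = (1 - ax)by - (1 - x), which is
    -- where p = ab enters. The ratio of consecutive summands then absorbs (1 - ax)by into the
    -- summand of index s + 1.
    τ-telescopes : ∀ n s → τ (suc n) s - τ n s ≈ β⁻¹ n * (τ n (suc s) * (1# - p * p ^ s)) - β⁻¹ n * (τ n s * (1# - p ^ s))
    τ-telescopes n s = begin
      τ (suc n) s - τ n s                                                                  ≈⟨ +-congʳ (τ-suc-n n s) ⟩
      T * (x * (1# - p * y) * w) - T                                                       ≈⟨ +-congˡ (-‿cong (*-identityʳ T)) ⟨
      T * (x * (1# - p * y) * w) - T * 1#                                                  ≈⟨ +-congˡ (-‿cong (*-congˡ (proj₂ (β-unit n)))) ⟨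
      T * (x * (1# - p * y) * w) - T * ((1# - b * y) * w)                                  ≈⟨ +-congʳ (*-congˡ (*-congʳ (*-congˡ (+-congˡ (-‿cong (*-congʳ (sym ab≈p))))))) ⟩
      T * (x * (1# - a * b * y) * w) - T * ((1# - b * y) * w)                              ≈⟨ solve 6 (λ T x a b y w → T :* (x :* (con (+ 1) :- a :* b :* y) :* w) :- T :* ((con (+ 1) :- b :* y) :* w)
                                                                                                 := w :* (T :* ((con (+ 1) :- a :* x) :* (b :* y))) :- w :* (T :* (con (+ 1) :- x))) refl T x a b y w ⟩
      w * (T * ((1# - a * x) * (b * y))) - w * (T * (1# - x))                              ≈⟨ +-congʳ (*-congˡ (τ-suc-s n s)) ⟨
      w * (τ n (suc s) * (1# - p * x)) - w * (T * (1# - x))                                ∎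
      where
      T = τ n s
      x = p ^ s
      y = p ^ n
      w = β⁻¹ n

    τ-diagonal : ∀ n → τ n n ≈ ρ n * (b * p ^ n) ^ n
    τ-diagonal n = *-congʳ (begin
      poch p p n * B⁻¹ n * (poch a p n * A⁻¹ n)    ≈⟨ solve 4 (λ P B⁻¹ A A⁻¹ → P :* B⁻¹ :* (A :* A⁻¹) := B⁻¹ :* A :* (P :* A⁻¹)) refl (poch p p n) (B⁻¹ n) (poch a p n) (A⁻¹ n) ⟩
      ρ n * (poch p p n * A⁻¹ n)                 ≈⟨ *-congˡ (∏-inverse (λ i → proj₂ (α-unit i)) n) ⟩
      ρ n * 1#                                 ≈⟨ *-identityʳ _ ⟩
      ρ n                                      ∎)

    term : ℕ → Carrier
    term k = ρ (suc k) * (b * p ^ k) ^ suc k * (1# + p ^ suc k)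

    -- The lower end of the telescoped sum vanishes because 1 - p⁰ = 0. The upper end is
    -- `ρ (suc n) * z`, and the additional diagonal summand is pⁿ⁺¹ times that, whence the factor 1
    -- + pⁿ⁺¹ of `term`.
    S-suc : ∀ n → ∑ (τ (suc n)) (suc (suc n)) ≈ ∑ (τ n) (suc n) + term n
    S-suc n = begin
      S′ + τ (suc n) (suc n)                                    ≈⟨ solve 3 (λ a b c → a :+ c := b :+ (a :- b) :+ c) refl S′ S (τ (suc n) (suc n)) ⟩
      S + (S′ - S) + τ (suc n) (suc n)                          ≈⟨ +-cong (+-congˡ difference) (trans (τ-diagonal (suc n)) last) ⟩
      S + ρ (suc n) * z + ρ (suc n) * (p ^ suc n * z)           ≈⟨ solve 4 (λ S r z x → S :+ r :* z :+ r :* (x :* z) := S :+ r :* z :* (con (+ 1) :+ x)) refl S (ρ (suc n)) z (p ^ suc n) ⟩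
      S + term n                                                ∎
      where
      S = ∑ (τ n) (suc n)
      S′ = ∑ (τ (suc n)) (suc n)
      z = (b * p ^ n) ^ suc n
      g : ℕ → Carrier
      g s = β⁻¹ n * (τ n s * (1# - p ^ s))
      last : ρ (suc n) * (b * p ^ suc n) ^ suc n ≈ ρ (suc n) * (p ^ suc n * z)
      last = *-congˡ (trans (^-congˡ (suc n) (solve 3 (λ b p r → b :* (p :* r) := p :* (b :* r)) refl b p (p ^ n))) (^-distrib-* p (b * p ^ n) (suc n)))
      difference : S′ - S ≈ ρ (suc n) * z
      difference = begin
        S′ - S                                                  ≈⟨ ∑-difference (τ (suc n)) (τ n) (suc n) ⟨
        ∑ (λ s → τ (suc n) s - τ n s) (suc n)                   ≈⟨ ∑-telescope {g = g} (τ-telescopes n) (suc n) ⟩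
        g (suc n) - g 0                                         ≈⟨ +-congˡ (-‿cong (solve 2 (λ w τ → w :* (τ :* (con (+ 1) :- con (+ 1))) := con (+ 0)) refl (β⁻¹ n) (τ n 0))) ⟩
        g (suc n) - 0#                                          ≈⟨ solve 1 (λ x → x :- con (+ 0) := x) refl (g (suc n)) ⟩
        β⁻¹ n * (τ n (suc n) * (1# - p * p ^ n))                  ≈⟨ *-congˡ (τ-suc-s n n) ⟩
        β⁻¹ n * (τ n n * ((1# - a * p ^ n) * (b * p ^ n)))        ≈⟨ *-congˡ (*-congʳ (τ-diagonal n)) ⟩
        β⁻¹ n * (B⁻¹ n * poch a p n * (b * p ^ n) ^ n * ((1# - a * p ^ n) * (b * p ^ n)))  ≈⟨ solve 6 (λ w B⁻¹ A y c z → w :* (B⁻¹ :* A :* y :* (c :* z)) := B⁻¹ :* w :* (A :* c) :* (z :* y)) refl (β⁻¹ n) (B⁻¹ n) (poch a p n) ((b * p ^ n) ^ n) (1# - a * p ^ n) (b * p ^ n) ⟩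
        ρ (suc n) * z                                           ∎

    finite-identity : ∀ n → ∑ (τ n) (suc n) ≈ 1# + ∑ term n
    finite-identity zero    = solve 0 (con (+ 0) :+ con (+ 1) :* con (+ 1) :* (con (+ 1) :* con (+ 1)) :* con (+ 1) := con (+ 1) :+ con (+ 0)) refl
    finite-identity (suc n) = trans (S-suc n) (trans (+-congʳ (finite-identity n)) (+-assoc _ _ _))

    S-limit : ∀ n → p ^ n ≈ 0# → ∀ m → ∑ (τ n) (suc m) ≈ poch p p n * B⁻¹ n
    S-limit n p^n≈0 zero    = solve 1 (λ x → con (+ 0) :+ x :* (con (+ 1) :* con (+ 1)) :* con (+ 1) := x) refl (poch p p n * B⁻¹ n)
    S-limit n p^n≈0 (suc m) = begin
      ∑ (τ n) (suc m) + τ n (suc m)     ≈⟨ +-cong (S-limit n p^n≈0 m) (*-congˡ (*-congʳ (*-congˡ p^n≈0))) ⟩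
      poch p p n * B⁻¹ n + poch p p n * B⁻¹ n * (poch a p (suc m) * A⁻¹ (suc m)) * (b * 0# * (b * p ^ n) ^ m)
                                        ≈⟨ solve 4 (λ x y b z → x :+ x :* y :* (b :* con (+ 0) :* z) := x) refl (poch p p n * B⁻¹ n) (poch a p (suc m) * A⁻¹ (suc m)) b ((b * p ^ n) ^ m) ⟩
      poch p p n * B⁻¹ n                  ∎

    identity : ∀ n → p ^ n ≈ 0# → (1# + ∑ term n) * poch b p n ≈ poch p p n
    identity n p^n≈0 = begin
      (1# + ∑ term n) * poch b p n          ≈⟨ *-congʳ (trans (sym (finite-identity n)) (S-limit n p^n≈0 n)) ⟩
      poch p p n * B⁻¹ n * poch b p n         ≈⟨ solve 3 (λ x y z → x :* y :* z := x :* (z :* y)) refl (poch p p n) (B⁻¹ n) (poch b p n) ⟩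
      poch p p n * (poch b p n * B⁻¹ n)       ≈⟨ *-congˡ (∏-inverse (λ i → proj₂ (β-unit i)) n) ⟩
      poch p p n * 1#                       ≈⟨ *-identityʳ _ ⟩
      poch p p n                            ∎

-- The theta functions φ and ψ as sums and as products

module Theta {c ℓ} (R : CommutativeRing c ℓ) where

  open Products R
  open import Relation.Binary.Reasoning.Setoid setoid

  ∑-cong : ∀ {f g} → (∀ i → f i ≈ g i) → ∀ n → ∑ f n ≈ ∑ g n
  ∑-cong f≈g zero    = refl
  ∑-cong f≈g (suc n) = +-cong (∑-cong f≈g n) (f≈g n)

  ^-double : ∀ x n → x ^ (n ℕ.* 2) ≈ (x * x) ^ n
  ^-double x zero    = refl
  ^-double x (suc n) = trans (*-congˡ (*-congˡ (^-double x n))) (sym (*-assoc x x _))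

  neg-^-even : ∀ x n → (- x) ^ (n ℕ.* 2) ≈ x ^ (n ℕ.* 2)
  neg-^-even x n = begin
    (- x) ^ (n ℕ.* 2)    ≈⟨ ^-double (- x) n ⟩
    (- x * - x) ^ n      ≈⟨ ^-congˡ n (solve 1 (λ x → :- x :* :- x := x :* x) refl x) ⟩
    (x * x) ^ n          ≈⟨ ^-double x n ⟨
    x ^ (n ℕ.* 2)        ∎

  neg-^-odd : ∀ x n → (- x) ^ suc (n ℕ.* 2) ≈ - (x ^ suc (n ℕ.* 2))
  neg-^-odd x n = trans (*-congˡ (neg-^-even x n)) (solve 2 (λ x y → :- x :* y := :- (x :* y)) refl x _)

  poch-± : ∀ a p n → poch (- a) p n * poch a p n ≈ poch (a * a) (p * p) n
  poch-± a p n = trans (sym (∏-* _ _ n)) (∏-cong factor n)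
    where
    factor : ∀ i → (1# - - a * p ^ i) * (1# - a * p ^ i) ≈ 1# - a * a * (p * p) ^ i
    factor i = trans (solve 2 (λ a y → (con (+ 1) :- :- a :* y) :* (con (+ 1) :- a :* y) := con (+ 1) :- a :* a :* (y :* y)) refl a (p ^ i))
                     (+-congˡ (-‿cong (*-congˡ (sym (^-distrib-* p p i)))))

  poch-double : ∀ a p n → poch a p (n ℕ.* 2) ≈ poch a (p * p) n * poch (a * p) (p * p) n
  poch-double a p zero    = sym (*-identityˡ 1#)
  poch-double a p (suc n) = begin
    poch a p (n ℕ.* 2) * (1# - a * p ^ (n ℕ.* 2)) * (1# - a * (p * p ^ (n ℕ.* 2)))
      ≈⟨ *-cong (*-cong (poch-double a p n) (+-congˡ (-‿cong (*-congˡ (^-double p n))))) (+-congˡ (-‿cong (*-congˡ (*-congˡ (^-double p n))))) ⟩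
    X * Y * (1# - a * z) * (1# - a * (p * z))
      ≈⟨ solve 5 (λ X Y a p z → X :* Y :* (con (+ 1) :- a :* z) :* (con (+ 1) :- a :* (p :* z)) := X :* (con (+ 1) :- a :* z) :* (Y :* (con (+ 1) :- a :* p :* z))) refl X Y a p z ⟩
    X * (1# - a * z) * (Y * (1# - a * p * z))      ∎
    where
    X = poch a (p * p) n
    Y = poch (a * p) (p * p) n
    z = (p * p) ^ n

  -- Sorting factors by the parity of the exponent needs 2n of them on the left; those beyond the
  -- n-th are 1, so all three products can have the same length.
  poch-odd-even : ∀ z n → z ^ n ≈ 0# → poch z z n ≈ poch z (z * z) n * poch (z * z) (z * z) n
  poch-odd-even z n z^n≈0 = trans (sym (poch-stable z z^n≈0 (n ℕ.* 2) (ℕₚ.m≤m*n n 2))) (poch-double z z n)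

  -- The partial sum of 1 + 2 Σ (-1)^j p^(j²), that is, of φ(-p). Mind the sign: `theta y` is φ(-y),
  -- and `theta (- y)` is φ(y).
  theta : Carrier → ℕ → Carrier
  theta p n = 1# + ∑ (λ k → (- (p ^ suc k)) ^ suc k * (1# + 1#)) n

  theta-product : ∀ p n → p ^ n ≈ 0# → theta p n * poch (- p) p n ≈ poch p p n
  theta-product p n p^n≈0 = trans (*-congʳ (+-congˡ (∑-cong term-value n))) (identity n p^n≈0)
    where
    open Shanks {a = - 1#} {b = - p} {p = p} (solve 1 (λ p → :- con (+ 1) :* :- p := p) refl p) (n , p^n≈0) (n , neg-^-zero p n p^n≈0)

    -- In (-1; p) / (-p; p), both of length k + 1, everything cancels except the first factor 2
    -- above and the last factor 1 + pᵏ⁺¹ below. The choice a = -1, b = -p thus turns `term` into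
    -- twice a signed power with square exponent.
    ρ-value : ∀ k → ρ (suc k) * (1# + p ^ suc k) ≈ 1# + 1#
    ρ-value zero = begin
      1# * β⁻¹ 0 * (1# * (1# - - 1# * 1#)) * (1# + p * 1#)    ≈⟨ solve 2 (λ β⁻¹ p → con (+ 1) :* β⁻¹ :* (con (+ 1) :* (con (+ 1) :- :- con (+ 1) :* con (+ 1))) :* (con (+ 1) :+ p :* con (+ 1)) := (con (+ 1) :- :- p :* con (+ 1)) :* β⁻¹ :* con (+ 2)) refl (β⁻¹ 0) p ⟩
      (1# - - p * 1#) * β⁻¹ 0 * (1# + 1#)                     ≈⟨ *-congʳ (proj₂ (β-unit 0)) ⟩
      1# * (1# + 1#)                                        ≈⟨ *-identityˡ _ ⟩
      1# + 1#                                               ∎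
    ρ-value (suc k) = begin
      B⁻¹ (suc k) * w * (A * (1# - - 1# * y)) * (1# + p * y)    ≈⟨ solve 5 (λ B⁻¹ w A y p → B⁻¹ :* w :* (A :* (con (+ 1) :- :- con (+ 1) :* y)) :* (con (+ 1) :+ p :* y) := B⁻¹ :* A :* (con (+ 1) :+ y) :* ((con (+ 1) :- :- p :* y) :* w)) refl (B⁻¹ (suc k)) w A y p ⟩
      ρ (suc k) * (1# + y) * ((1# - - p * y) * w)             ≈⟨ *-cong (ρ-value k) (proj₂ (β-unit (suc k))) ⟩
      (1# + 1#) * 1#                                          ≈⟨ *-identityʳ _ ⟩
      1# + 1#                                                 ∎
      where
      w = β⁻¹ (suc k)
      A = poch (- 1#) p (suc k)
      y = p ^ suc k

    term-value : ∀ k → (- (p ^ suc k)) ^ suc k * (1# + 1#) ≈ term k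
    term-value k = begin
      (- (p ^ suc k)) ^ suc k * (1# + 1#)                        ≈⟨ *-cong (^-congˡ (suc k) (solve 2 (λ p y → :- (p :* y) := :- p :* y) refl p (p ^ k))) (sym (ρ-value k)) ⟩
      (- p * p ^ k) ^ suc k * (ρ (suc k) * (1# + p ^ suc k))     ≈⟨ solve 3 (λ x y z → x :* (y :* z) := y :* x :* z) refl ((- p * p ^ k) ^ suc k) (ρ (suc k)) (1# + p ^ suc k) ⟩
      term k                                                     ∎

  -- The partial sum of ψ(w) = Σ w^(j(j+1)/2) up to j = 2n. Summand k joins the triangular numbers
  -- (2k + 1)(k + 1) and (2k + 3)(k + 1), those of index 2k + 1 and 2k + 2.
  psi : Carrier → ℕ → Carrier
  psi w n = 1# + ∑ (λ k → (w * (w * w) ^ k) ^ suc k * (1# + (w * w) ^ suc k)) n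

  psi-product : ∀ w n → w ^ n ≈ 0# → psi w n * poch w (w * w) n ≈ poch (w * w) (w * w) n
  psi-product w n w^n≈0 = trans (*-congʳ (+-congˡ (∑-cong term-value n))) (identity n (*-^-zero w w n w^n≈0))
    where
    -- With a = b the quotient `ρ` of (a; p) by (b; p) is 1.
    open Shanks {a = w} {b = w} {p = w * w} refl (n , *-^-zero w w n w^n≈0) (n , w^n≈0)

    term-value : ∀ k → (w * (w * w) ^ k) ^ suc k * (1# + (w * w) ^ suc k) ≈ term k
    term-value k = *-congʳ (begin
      z                    ≈⟨ *-identityˡ z ⟨
      1# * z               ≈⟨ *-congʳ (∏-inverse (λ i → trans (*-comm _ _) (proj₂ (β-unit i))) (suc k)) ⟨
      ρ (suc k) * z        ∎)
      where z = (w * (w * w) ^ k) ^ suc k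

  odd-squares : Carrier → ℕ → Carrier
  odd-squares x = ∑ (λ j → (x ^ suc (j ℕ.* 2)) ^ suc (j ℕ.* 2))

  -- The terms are taken in pairs of an odd and an even index. At an odd index the coefficient is -2
  -- in `theta x` and 2 in `theta (- x)`, a difference of 4; at an even index both agree.
  theta-odd-part : ∀ x n → theta (- x) (n ℕ.* 2) ≈ theta x (n ℕ.* 2) + (1# + 1# + 1# + 1#) * odd-squares x n
  theta-odd-part x zero    = solve 0 (con (+ 1) :+ con (+ 0) := con (+ 1) :+ con (+ 0) :+ con (+ 4) :* con (+ 0)) refl
  theta-odd-part x (suc n) = begin
    1# + (X + a * (1# + 1#) + b * (1# + 1#))              ≈⟨ solve 3 (λ X a b → con (+ 1) :+ (X :+ a :* con (+ 2) :+ b :* con (+ 2)) := con (+ 1) :+ X :+ a :* con (+ 2) :+ b :* con (+ 2)) refl X a b ⟩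
    1# + X + a * (1# + 1#) + b * (1# + 1#)                ≈⟨ +-cong (+-cong (theta-odd-part x n) (*-congʳ a≈)) (*-congʳ b≈) ⟩
    1# + Y + (1# + 1# + 1# + 1#) * Z + s * (1# + 1#) + b′ * (1# + 1#)
                                                          ≈⟨ solve 4 (λ Y Z s b → con (+ 1) :+ Y :+ con (+ 4) :* Z :+ s :* con (+ 2) :+ b :* con (+ 2) := con (+ 1) :+ (Y :+ :- s :* con (+ 2) :+ b :* con (+ 2)) :+ con (+ 4) :* (Z :+ s)) refl Y Z s b′ ⟩
    1# + (Y + - s * (1# + 1#) + b′ * (1# + 1#)) + (1# + 1# + 1# + 1#) * (Z + s)
                                                          ≈⟨ +-congʳ (+-congˡ (+-congʳ (+-congˡ (*-congʳ (neg-^-odd (x ^ m) n))))) ⟨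
    1# + (Y + a′ * (1# + 1#) + b′ * (1# + 1#)) + (1# + 1# + 1# + 1#) * (Z + s)  ∎
    where
    m = suc (n ℕ.* 2)
    X = ∑ (λ k → (- ((- x) ^ suc k)) ^ suc k * (1# + 1#)) (n ℕ.* 2)
    Y = ∑ (λ k → (- (x ^ suc k)) ^ suc k * (1# + 1#)) (n ℕ.* 2)
    Z = odd-squares x n
    a = (- ((- x) ^ m)) ^ m
    b = (- ((- x) ^ suc m)) ^ suc m
    a′ = (- (x ^ m)) ^ m
    b′ = (- (x ^ suc m)) ^ suc m
    s = (x ^ m) ^ m
    a≈ : a ≈ s
    a≈ = ^-congˡ m (trans (-‿cong (neg-^-odd x n)) (solve 1 (λ x → :- :- x := x) refl _))
    b≈ : b ≈ b′
    b≈ = ^-congˡ (suc m) (-‿cong (neg-^-even x (suc n)))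

  -- Since (2j + 1)² = 8 · j(j + 1)/2 + 1, the odd squares with 0 ≤ j ≤ 2n match the constant term
  -- and the n pairs of `psi`.
  odd-squares-psi : ∀ x n → odd-squares x (suc (n ℕ.* 2)) ≈ x * psi (x ^ 8) n
  odd-squares-psi x zero    = solve 1 (λ x → con (+ 0) :+ x :* con (+ 1) :* con (+ 1) := x :* (con (+ 1) :+ con (+ 0))) refl x
  odd-squares-psi x (suc n) = begin
    odd-squares x (suc (n ℕ.* 2)) + (x ^ m₁) ^ m₁ + (x ^ m₂) ^ m₂    ≈⟨ +-cong (+-cong (odd-squares-psi x n) first) second ⟩
    x * (1# + Y) + x * y + x * (y * z)                               ≈⟨ solve 4 (λ x Y y z → x :* (con (+ 1) :+ Y) :+ x :* y :+ x :* (y :* z) := x :* (con (+ 1) :+ (Y :+ y :* (con (+ 1) :+ z)))) refl x Y y z ⟩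
    x * (1# + (Y + y * (1# + z)))                                    ∎
    where
    m₁ = suc (suc (n ℕ.* 2) ℕ.* 2)
    m₂ = suc (suc (suc (n ℕ.* 2)) ℕ.* 2)
    w = x ^ 8
    Y = ∑ (λ k → (w * (w * w) ^ k) ^ suc k * (1# + (w * w) ^ suc k)) n
    y = (w * (w * w) ^ n) ^ suc n
    z = (w * w) ^ suc n
    ww-^ : ∀ k → (w * w) ^ k ≈ x ^ (16 ℕ.* k)
    ww-^ k = trans (^-congˡ k (sym (^-homo-* x 8 8))) (^-assocʳ x 16 k)
    y≈ : y ≈ x ^ ((8 ℕ.+ 16 ℕ.* n) ℕ.* suc n)
    y≈ = begin
      (w * (w * w) ^ n) ^ suc n              ≈⟨ ^-congˡ (suc n) (*-congˡ (ww-^ n)) ⟩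
      (x ^ 8 * x ^ (16 ℕ.* n)) ^ suc n       ≈⟨ ^-congˡ (suc n) (^-homo-* x 8 (16 ℕ.* n)) ⟨
      (x ^ (8 ℕ.+ 16 ℕ.* n)) ^ suc n         ≈⟨ ^-assocʳ x (8 ℕ.+ 16 ℕ.* n) (suc n) ⟩
      x ^ ((8 ℕ.+ 16 ℕ.* n) ℕ.* suc n)       ∎
    exponent₁ : ∀ n → suc (suc (n ℕ.* 2) ℕ.* 2) ℕ.* suc (suc (n ℕ.* 2) ℕ.* 2) ≡ suc ((8 ℕ.+ 16 ℕ.* n) ℕ.* suc n)
    exponent₁ = ℕ-Solver.solve-∀
    exponent₂ : ∀ n → suc (suc (suc (n ℕ.* 2)) ℕ.* 2) ℕ.* suc (suc (suc (n ℕ.* 2)) ℕ.* 2) ≡ suc ((8 ℕ.+ 16 ℕ.* n) ℕ.* suc n ℕ.+ 16 ℕ.* suc n)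
    exponent₂ = ℕ-Solver.solve-∀
    first : (x ^ m₁) ^ m₁ ≈ x * y
    first = begin
      (x ^ m₁) ^ m₁                                   ≈⟨ ^-assocʳ x m₁ m₁ ⟩
      x ^ (m₁ ℕ.* m₁)                                 ≈⟨ ^-congʳ x (exponent₁ n) ⟩
      x * x ^ ((8 ℕ.+ 16 ℕ.* n) ℕ.* suc n)            ≈⟨ *-congˡ y≈ ⟨
      x * y                                           ∎
    second : (x ^ m₂) ^ m₂ ≈ x * (y * z)
    second = begin
      (x ^ m₂) ^ m₂                                                  ≈⟨ ^-assocʳ x m₂ m₂ ⟩
      x ^ (m₂ ℕ.* m₂)                                                ≈⟨ ^-congʳ x (exponent₂ n) ⟩
      x * x ^ ((8 ℕ.+ 16 ℕ.* n) ℕ.* suc n ℕ.+ 16 ℕ.* suc n)          ≈⟨ *-congˡ (^-homo-* x ((8 ℕ.+ 16 ℕ.* n) ℕ.* suc n) (16 ℕ.* suc n)) ⟩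
      x * (x ^ ((8 ℕ.+ 16 ℕ.* n) ℕ.* suc n) * x ^ (16 ℕ.* suc n))    ≈⟨ *-congˡ (*-cong y≈ (ww-^ (suc n))) ⟨
      x * (y * z)                                                    ∎

  -- Multiplying (-z; z²) by (z; z²) gives (z²; z⁴), and the factors with the missing exponents
  -- complete (z; z²) to (z; z) and (z²; z⁴) to (z²; z²). Hence (-z; z²) is a quotient of products
  -- of the form (zᵏ; zᵏ).
  poch-odd-plus : ∀ z m → z ^ m ≈ 0# → let w = z * z in
                  poch (- z) w m * poch z z m * poch (w * w) (w * w) m ≈ poch w w m * poch w w m
  poch-odd-plus z m z^m≈0 = begin
    poch (- z) w m * poch z z m * e₄                       ≈⟨ *-congʳ (*-congˡ (poch-odd-even z m z^m≈0)) ⟩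
    poch (- z) w m * (poch z w m * poch w w m) * e₄        ≈⟨ solve 4 (λ a b c d → a :* (b :* c) :* d := a :* b :* d :* c) refl (poch (- z) w m) (poch z w m) (poch w w m) e₄ ⟩
    poch (- z) w m * poch z w m * e₄ * poch w w m          ≈⟨ *-congʳ (*-congʳ (poch-± z w m)) ⟩
    poch w (w * w) m * e₄ * poch w w m                     ≈⟨ *-congʳ (poch-odd-even w m (*-^-zero z z m z^m≈0)) ⟨
    poch w w m * poch w w m                                ∎
    where
    w = z * z
    e₄ = poch (w * w) (w * w) m

  theta-square : ∀ p m n → p ^ m ≈ 0# → m ℕ.≤ n → theta p n * poch (p * p) (p * p) m ≈ poch p p m * poch p p m
  theta-square p m n p^m≈0 m≤n = begin
    theta p n * poch (p * p) (p * p) m            ≈⟨ *-congˡ (poch-± p p m) ⟨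
    theta p n * (poch (- p) p m * poch p p m)     ≈⟨ *-assoc _ _ _ ⟨
    theta p n * poch (- p) p m * poch p p m       ≈⟨ *-congʳ (*-congˡ (poch-stable (- p) p^m≈0 n m≤n)) ⟨
    theta p n * poch (- p) p n * poch p p m       ≈⟨ *-congʳ (theta-product p n (^-zero-mono m≤n p^m≈0)) ⟩
    poch p p n * poch p p m                       ≈⟨ *-congʳ (poch-stable p p^m≈0 n m≤n) ⟩
    poch p p m * poch p p m                       ∎

  psi-square : ∀ w m → w ^ m ≈ 0# → psi w m * poch w w m ≈ poch (w * w) (w * w) m * poch (w * w) (w * w) m
  psi-square w m w^m≈0 = begin
    psi w m * poch w w m                                            ≈⟨ *-congˡ (poch-odd-even w m w^m≈0) ⟩
    psi w m * (poch w (w * w) m * poch (w * w) (w * w) m)           ≈⟨ *-assoc _ _ _ ⟨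
    psi w m * poch w (w * w) m * poch (w * w) (w * w) m             ≈⟨ *-congʳ (psi-product w m w^m≈0) ⟩
    poch (w * w) (w * w) m * poch (w * w) (w * w) m                 ∎

-- The coefficients of the product in z and their limit

module Stanley {c ℓ} (R : CommutativeRing c ℓ) where

  open Products R
  open Theta R
  open import Relation.Binary.Reasoning.Setoid setoid

  -- d q y N K is the coefficient of zᴺ in ∏_{k < K} (1 + z q yᵏ) / (1 - z (-y)ᵏ); for
  -- y = q² and K = ∞ it enumerates, with signs, the partitions with at most N parts
  -- whose odd parts are distinct.
  d : Carrier → Carrier → ℕ → ℕ → Carrier
  d q y zero    K       = 1#
  d q y (suc N) zero    = 0#
  d q y (suc N) (suc K) = d q y (suc N) K + q * y ^ K * d q y N K + (- y) ^ K * d q y N (suc K)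

  -- The definition of d adds the last factor of the product; here the first factor
  -- is removed, which turns (z, q) into (-yz, -q).
  d-front : ∀ {q q̄} y → q̄ ≈ - q → ∀ N K →
            d q y (suc N) (suc K) ≈ d q y N (suc K) + (- y) ^ suc N * d q̄ y (suc N) K + q * (- y) ^ N * d q̄ y N K
  d-front {q} {q̄} y q̄≈-q zero zero =
    solve 2 (λ q y → con (+ 0) :+ q :* con (+ 1) :* con (+ 1) :+ con (+ 1) :* con (+ 1) := con (+ 1) :+ :- y :* con (+ 1) :* con (+ 0) :+ q :* con (+ 1) :* con (+ 1)) refl q y
  d-front {q} {q̄} y q̄≈-q (suc N) zero =
    solve 4 (λ q D z w → con (+ 0) :+ q :* con (+ 1) :* con (+ 0) :+ con (+ 1) :* D := D :+ z :* con (+ 0) :+ q :* w :* con (+ 0)) refl q (d q y (suc N) 1) ((- y) ^ suc (suc N)) ((- y) ^ suc N)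
  d-front {q} {q̄} y q̄≈-q zero (suc K) = begin
    d q y 1 (suc K) + q * (y * Y) * 1# + - y * Z * 1#                       ≈⟨ +-congʳ (+-congʳ (d-front y q̄≈-q zero K)) ⟩
    1# + - y * 1# * D + q * 1# * 1# + q * (y * Y) * 1# + - y * Z * 1#       ≈⟨ solve 5 (λ q y D Y Z → con (+ 1) :+ :- y :* con (+ 1) :* D :+ q :* con (+ 1) :* con (+ 1) :+ q :* (y :* Y) :* con (+ 1) :+ :- y :* Z :* con (+ 1)
                                                                                 := con (+ 1) :+ :- y :* con (+ 1) :* (D :+ :- q :* Y :* con (+ 1) :+ Z :* con (+ 1)) :+ q :* con (+ 1) :* con (+ 1)) refl q y D Y Z ⟩
    1# + - y * 1# * (D + - q * Y * 1# + Z * 1#) + q * 1# * 1#               ≈⟨ +-congʳ (+-congˡ (*-congˡ (+-congʳ (+-congˡ (*-congʳ (*-congʳ q̄≈-q)))))) ⟨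
    1# + - y * 1# * (D + q̄ * Y * 1# + Z * 1#) + q * 1# * 1#                 ∎
    where
    D = d q̄ y 1 K
    Y = y ^ K
    Z = (- y) ^ K
  d-front {q} {q̄} y q̄≈-q (suc N) (suc K) = begin
    d q y (suc (suc N)) (suc K) + q * (y * Y) * d q y (suc N) (suc K) + - y * Z * d q y (suc N) (suc (suc K))
      ≈⟨ +-cong (+-cong (d-front y q̄≈-q (suc N) K) (*-congˡ (d-front y q̄≈-q N K))) (*-congˡ (d-front y q̄≈-q N (suc K))) ⟩
    A + W * C₂ + q * X * C₁ + q * (y * Y) * (A₀ + X * C₁ + q * X₀ * C₀) + - y * Z * (B₀ + X * E₁ + q * X₀ * E₀)
      -- The terms regroup into the defining recurrence of `d` at the companion parameter because q
      -- yᴷ⁺¹ (-y)ʲ = (-q) yᴷ (-y)ʲ⁺¹; this sign is what forces q to become -q.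
      ≈⟨ rearrange ⟩
    (A + q * (y * Y) * A₀ + - y * Z * B₀) + W * (C₂ + - q * Y * C₁ + Z * E₁) + q * X * (C₁ + - q * Y * C₀ + Z * E₀)
      ≈⟨ +-cong (+-congˡ (*-congˡ (+-congʳ (+-congˡ (*-congʳ (*-congʳ q̄≈-q)))))) (*-congˡ (+-congʳ (+-congˡ (*-congʳ (*-congʳ q̄≈-q))))) ⟨
    (A + q * (y * Y) * A₀ + - y * Z * B₀) + W * (C₂ + q̄ * Y * C₁ + Z * E₁) + q * X * (C₁ + q̄ * Y * C₀ + Z * E₀)      ∎
    where
    Y = y ^ K
    Z = (- y) ^ K
    X₀ = (- y) ^ N
    X = - y * X₀
    W = - y * X
    A = d q y (suc N) (suc K)
    A₀ = d q y N (suc K)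
    B₀ = d q y N (suc (suc K))
    C₂ = d q̄ y (suc (suc N)) K
    C₁ = d q̄ y (suc N) K
    C₀ = d q̄ y N K
    E₁ = d q̄ y (suc N) (suc K)
    E₀ = d q̄ y N (suc K)
    rearrange : A + W * C₂ + q * X * C₁ + q * (y * Y) * (A₀ + X * C₁ + q * X₀ * C₀) + - y * Z * (B₀ + X * E₁ + q * X₀ * E₀)
              ≈ (A + q * (y * Y) * A₀ + - y * Z * B₀) + W * (C₂ + - q * Y * C₁ + Z * E₁) + q * X * (C₁ + - q * Y * C₀ + Z * E₀)
    rearrange = solve 13 (λ q y Y Z X₀ A A₀ B₀ C₂ C₁ C₀ E₁ E₀ →
        A :+ :- y :* (:- y :* X₀) :* C₂ :+ q :* (:- y :* X₀) :* C₁ :+ q :* (y :* Y) :* (A₀ :+ :- y :* X₀ :* C₁ :+ q :* X₀ :* C₀) :+ :- y :* Z :* (B₀ :+ :- y :* X₀ :* E₁ :+ q :* X₀ :* E₀)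
        := (A :+ q :* (y :* Y) :* A₀ :+ :- y :* Z :* B₀) :+ :- y :* (:- y :* X₀) :* (C₂ :+ :- q :* Y :* C₁ :+ Z :* E₁) :+ q :* (:- y :* X₀) :* (C₁ :+ :- q :* Y :* C₀ :+ Z :* E₀))
      refl q y Y Z X₀ A A₀ B₀ C₂ C₁ C₀ E₁ E₀

  module Limits {y : Carrier} (m : ℕ) (y^m≈0 : y ^ m ≈ 0#) where

    -y^m≈0 : ∀ {n} → m ℕ.≤ n → (- y) ^ n ≈ 0#
    -y^m≈0 m≤n = ^-zero-mono m≤n (neg-^-zero y m y^m≈0)

    d-stable-K : ∀ q N K → m ℕ.≤ K → d q y N (suc K) ≈ d q y N K
    d-stable-K q zero    K m≤K = refl
    d-stable-K q (suc N) K m≤K = begin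
      D + q * y ^ K * D′ + (- y) ^ K * D″    ≈⟨ +-cong (+-congˡ (*-congʳ (*-congˡ (^-zero-mono m≤K y^m≈0)))) (*-congʳ (-y^m≈0 m≤K)) ⟩
      D + q * 0# * D′ + 0# * D″              ≈⟨ solve 4 (λ q D D′ D″ → D :+ q :* con (+ 0) :* D′ :+ con (+ 0) :* D″ := D) refl q D D′ D″ ⟩
      D                                      ∎
      where
      D = d q y (suc N) K
      D′ = d q y N K
      D″ = d q y N (suc K)

    -- Owing to the factor 1/(1 - z), present as soon as there is one factor, the coefficients are
    -- partial sums; the increments found by `d-front` carry powers of -y that vanish for N ≥ m.
    d-stable-N : ∀ q N K → m ℕ.≤ N → d q y (suc N) (suc K) ≈ d q y N (suc K)
    d-stable-N q N K m≤N = begin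
      d q y (suc N) (suc K)                               ≈⟨ d-front y refl N K ⟩
      D + (- y) ^ suc N * D′ + q * (- y) ^ N * D″         ≈⟨ +-cong (+-congˡ (*-congʳ (-y^m≈0 (ℕₚ.m≤n⇒m≤1+n m≤N)))) (*-congʳ (*-congˡ (-y^m≈0 m≤N))) ⟩
      D + 0# * D′ + q * 0# * D″                           ≈⟨ solve 4 (λ q D D′ D″ → D :+ con (+ 0) :* D′ :+ q :* con (+ 0) :* D″ := D) refl q D D′ D″ ⟩
      D                                                   ∎
      where
      D = d q y N (suc K)
      D′ = d (- q) y (suc N) K
      D″ = d (- q) y N K

    -- The stable coefficient is the value at z = 1 after removal of 1/(1 - z). The removed
    -- denominator has no counterpart in the numerator, which therefore keeps one factor more.
    d-product : ∀ q N K → m ℕ.≤ N → d q y (suc N) (suc K) * poch (- y) (- y) K ≈ poch (- q) y (suc K)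
    d-product q N zero m≤N = begin
      d q y (suc N) 1 * 1#              ≈⟨ *-identityʳ _ ⟩
      d q y (suc N) 1                   ≈⟨ one-column N ⟩
      1# + q                            ≈⟨ solve 1 (λ q → con (+ 1) :+ q := con (+ 1) :* (con (+ 1) :- :- q :* con (+ 1))) refl q ⟩
      1# * (1# - - q * 1#)              ∎
      where
      one-column : ∀ N → d q y (suc N) 1 ≈ 1# + q
      one-column zero    = solve 1 (λ q → con (+ 0) :+ q :* con (+ 1) :* con (+ 1) :+ con (+ 1) :* con (+ 1) := con (+ 1) :+ q) refl q
      one-column (suc N) = trans (solve 2 (λ q D → con (+ 0) :+ q :* con (+ 1) :* con (+ 0) :+ con (+ 1) :* D := D) refl q (d q y (suc N) 1)) (one-column N)
    d-product q N (suc K) m≤N = begin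
      X * (P * (1# - - y * Z))                                        ≈⟨ solve 4 (λ X P y Z → X :* (P :* (con (+ 1) :- :- y :* Z)) := (X :- :- y :* Z :* X) :* P) refl X P y Z ⟩
      -- Replacing X by X′, the coefficient one degree lower, makes the recurrence of `d` cancel the
      -- denominator of the newly added factor; replacing D′ by D then produces its numerator at z =
      -- 1.
      (X - - y * Z * X) * P                                           ≈⟨ *-congʳ (+-congˡ (-‿cong (*-congˡ (d-stable-N q N (suc K) m≤N)))) ⟩
      (D + q * (y * Y) * D′ + - y * Z * X′ - - y * Z * X′) * P        ≈⟨ *-congʳ (+-congʳ (+-congʳ (+-congˡ (*-congˡ (d-stable-N q N K m≤N))))) ⟨
      (D + q * (y * Y) * D + - y * Z * X′ - - y * Z * X′) * P         ≈⟨ solve 7 (λ D q y Y Z X′ P → (D :+ q :* (y :* Y) :* D :+ :- y :* Z :* X′ :- :- y :* Z :* X′) :* P := D :* P :* (con (+ 1) :- :- q :* (y :* Y))) refl D q y Y Z X′ P ⟩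
      D * P * (1# - - q * (y * Y))                                    ≈⟨ *-congʳ (d-product q N K m≤N) ⟩
      poch (- q) y (suc K) * (1# - - q * (y * Y))                     ∎
      where
      X = d q y (suc N) (suc (suc K))
      X′ = d q y N (suc (suc K))
      D = d q y (suc N) (suc K)
      D′ = d q y N (suc K)
      P = poch (- y) (- y) K
      Y = y ^ K
      Z = (- y) ^ K

    d-step : ∀ {q q̄} → q̄ ≈ - q → ∀ N → let D = λ N → d q y N m ; D̄ = λ N → d q̄ y N m in
             D (suc N) ≈ D N + (- y) ^ suc N * D̄ (suc N) + q * (- y) ^ N * D̄ N
    d-step {q} {q̄} q̄≈-q N = begin
      d q y (suc N) m                 ≈⟨ d-stable-K q (suc N) m ℕₚ.≤-refl ⟨
      d q y (suc N) (suc m)           ≈⟨ d-front y q̄≈-q N m ⟩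
      d q y N (suc m) + (- y) ^ suc N * d q̄ y (suc N) m + q * (- y) ^ N * d q̄ y N m
                                      ≈⟨ +-congʳ (+-congʳ (d-stable-K q N m ℕₚ.≤-refl)) ⟩
      d q y N m + (- y) ^ suc N * d q̄ y (suc N) m + q * (- y) ^ N * d q̄ y N m  ∎

  eliminate : ∀ {ε G Ḡ H H̄} → G ≈ H + ε * Ḡ → Ḡ ≈ H̄ + ε * G → G * (1# - ε * ε) ≈ H + ε * H̄
  eliminate {ε} {G} {Ḡ} {H} {H̄} g ḡ = begin
    G * (1# - ε * ε)                  ≈⟨ solve 2 (λ G ε → G :* (con (+ 1) :- ε :* ε) := G :- ε :* (ε :* G)) refl G ε ⟩
    G - ε * (ε * G)                   ≈⟨ +-congʳ (trans g (+-congˡ (*-congˡ ḡ))) ⟩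
    H + ε * (H̄ + ε * G) - ε * (ε * G) ≈⟨ solve 4 (λ H H̄ ε G → H :+ ε :* (H̄ :+ ε :* G) :- ε :* (ε :* G) := H :+ ε :* H̄) refl H H̄ ε G ⟩
    H + ε * H̄                         ∎

  eliminate-twisted : ∀ {s G Ḡ H H̄} → G ≈ H + s * Ḡ → Ḡ ≈ H̄ - s * G → G * (1# + s * s) ≈ H + s * H̄
  eliminate-twisted {s} {G} {Ḡ} {H} {H̄} g ḡ = begin
    G * (1# + s * s)                  ≈⟨ solve 2 (λ G s → G :* (con (+ 1) :+ s :* s) := G :+ s :* (s :* G)) refl G s ⟩
    G + s * (s * G)                   ≈⟨ +-congʳ (trans g (+-congˡ (*-congˡ ḡ))) ⟩
    H + s * (H̄ - s * G) + s * (s * G) ≈⟨ solve 4 (λ H H̄ s G → H :+ s :* (H̄ :- s :* G) :+ s :* (s :* G) := H :+ s :* H̄) refl H H̄ s G ⟩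
    H + s * H̄                         ∎

  -- The subscripts 0, 1, 2 of F stand for the bounds 2N, 2N + 1, 2N + 2 on the parts, and `g` is
  -- the part of (-q²; q⁴) collected so far. After multiplication by 1 - ε², both sides equal D₀ + s
  -- D̄₀ + ε (D̄₀ - s D₀).
  double-step : ∀ {ε s D₀ D̄₀ D D̄ F₀ F̄₀ F₁ F̄₁ F₂ F̄₂ g} → Unit (1# - ε * ε) →
           D ≈ D₀ + ε * D̄ + s * D̄₀ → D̄ ≈ D̄₀ + ε * D - s * D₀ →
           F₁ ≈ F₀ + s * F̄₁ → F̄₁ ≈ F̄₀ - s * F₁ →
           F₂ ≈ F₁ + ε * F̄₂ → F̄₂ ≈ F̄₁ + ε * F₂ →
           F₀ * g ≈ D₀ → F̄₀ * g ≈ D̄₀ → F₂ * (g * (1# + s * s)) ≈ D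
  double-step {ε} {s} {D₀} {D̄₀} {D} {D̄} {F₀} {F̄₀} {F₁} {F̄₁} {F₂} {F̄₂} {g} unit hD hD̄ h₁ h̄₁ h₂ h̄₂ h₀ h̄₀ =
    unit-cancelʳ unit (begin
      F₂ * (g * (1# + s * s)) * (1# - ε * ε)                              ≈⟨ solve 4 (λ a b c d → a :* (b :* c) :* d := a :* d :* (b :* c)) refl F₂ g (1# + s * s) (1# - ε * ε) ⟩
      F₂ * (1# - ε * ε) * (g * (1# + s * s))                              ≈⟨ *-congʳ (eliminate h₂ h̄₂) ⟩
      (F₁ + ε * F̄₁) * (g * (1# + s * s))                                  ≈⟨ solve 5 (λ F₁ ε F̄₁ g w → (F₁ :+ ε :* F̄₁) :* (g :* w) := (F₁ :* w :+ ε :* (F̄₁ :* w)) :* g) refl F₁ ε F̄₁ g (1# + s * s) ⟩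
      (F₁ * (1# + s * s) + ε * (F̄₁ * (1# + s * s))) * g                   ≈⟨ *-congʳ (+-cong (eliminate-twisted h₁ h̄₁) (*-congˡ twisted)) ⟩
      (F₀ + s * F̄₀ + ε * (F̄₀ - s * F₀)) * g                               ≈⟨ solve 5 (λ F₀ s F̄₀ ε g → (F₀ :+ s :* F̄₀ :+ ε :* (F̄₀ :- s :* F₀)) :* g := F₀ :* g :+ s :* (F̄₀ :* g) :+ ε :* (F̄₀ :* g :- s :* (F₀ :* g))) refl F₀ s F̄₀ ε g ⟩
      F₀ * g + s * (F̄₀ * g) + ε * (F̄₀ * g - s * (F₀ * g))                 ≈⟨ +-cong (+-cong h₀ (*-congˡ h̄₀)) (*-congˡ (+-cong h̄₀ (-‿cong (*-congˡ h₀)))) ⟩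
      D₀ + s * D̄₀ + ε * (D̄₀ - s * D₀)                                     ≈⟨ eliminate (trans hD (solve 3 (λ a b c → a :+ b :+ c := a :+ c :+ b) refl D₀ (ε * D̄) (s * D̄₀)))
                                                                                        (trans hD̄ (solve 3 (λ a b c → a :+ b :- c := a :- c :+ b) refl D̄₀ (ε * D) (s * D₀))) ⟨
      D * (1# - ε * ε)                                                    ∎)
    where
    twisted : F̄₁ * (1# + s * s) ≈ F̄₀ - s * F₀
    twisted = begin
      F̄₁ * (1# + s * s)         ≈⟨ solve 2 (λ F s → F :* (con (+ 1) :+ s :* s) := F :* (con (+ 1) :+ :- s :* :- s)) refl F̄₁ s ⟩
      F̄₁ * (1# + - s * - s)     ≈⟨ eliminate-twisted (trans h̄₁ (solve 3 (λ a s b → a :- s :* b := a :+ :- s :* b) refl F̄₀ s F₁))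
                                                      (trans h₁ (solve 3 (λ a s b → a :+ s :* b := a :- :- s :* b) refl F₀ s F̄₁)) ⟩
      F̄₀ + - s * F₀             ≈⟨ solve 3 (λ a s b → a :+ :- s :* b := a :- s :* b) refl F̄₀ s F₀ ⟩
      F̄₀ - s * F₀               ∎

  -- From the signed recurrence to the product formula

  module Recurrence
    (q : Carrier) (m : ℕ) (q^m≈0 : q ^ m ≈ 0#)
    (F F̄ : ℕ → Carrier)
    (F-zero : F 0 ≈ 1#)
    (F̄-zero : F̄ 0 ≈ 1#)
    (F-odd  : ∀ j → F (suc (j ℕ.* 2)) ≈ F (j ℕ.* 2) + q * (- (q * q)) ^ j * F̄ (suc (j ℕ.* 2)))
    (F̄-odd  : ∀ j → F̄ (suc (j ℕ.* 2)) ≈ F̄ (j ℕ.* 2) - q * (- (q * q)) ^ j * F (suc (j ℕ.* 2)))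
    (F-even : ∀ j → F (suc j ℕ.* 2) ≈ F (suc (j ℕ.* 2)) + (- (q * q)) ^ suc j * F̄ (suc j ℕ.* 2))
    (F̄-even : ∀ j → F̄ (suc j ℕ.* 2) ≈ F̄ (suc (j ℕ.* 2)) + (- (q * q)) ^ suc j * F (suc j ℕ.* 2))
    where

    y : Carrier
    y = q * q

    y^m≈0 : y ^ m ≈ 0#
    y^m≈0 = *-^-zero q q m q^m≈0

    open Limits m y^m≈0

    h : ℕ → Carrier
    h = poch (- y) (y * y)

    -- As y = q², the element y y²ʲ is the square of s = q(-y)ʲ. So the factors of (-y; y²) are the
    -- determinants 1 + s² that `double-step` leaves behind.
    h-factor : ∀ j → 1# - - y * (y * y) ^ j ≈ 1# + q * (- y) ^ j * (q * (- y) ^ j)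
    h-factor j = begin
      1# - - y * (y * y) ^ j                ≈⟨ +-congˡ (-‿cong (*-congˡ (^-congˡ j (solve 1 (λ y → y :* y := :- y :* :- y) refl y)))) ⟩
      1# - - y * (- y * - y) ^ j            ≈⟨ +-congˡ (-‿cong (*-congˡ (^-distrib-* (- y) (- y) j))) ⟩
      1# - - y * ((- y) ^ j * (- y) ^ j)    ≈⟨ solve 2 (λ q z → con (+ 1) :- :- (q :* q) :* (z :* z) := con (+ 1) :+ q :* z :* (q :* z)) refl q ((- y) ^ j) ⟩
      1# + q * (- y) ^ j * (q * (- y) ^ j)  ∎

    -- Each step mixes F with F̄, so both statements are proved together. The second is the first
    -- with the companions exchanged and s replaced by -s, which does not affect the factor 1 + s².
    F-closed : ∀ N → F (N ℕ.* 2) * h N ≈ d q y N m × F̄ (N ℕ.* 2) * h N ≈ d (- q) y N m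
    F-closed zero    = trans (*-identityʳ _) F-zero , trans (*-identityʳ _) F̄-zero
    F-closed (suc N) with F-closed N
    ... | hF , hF̄ =
        trans (*-congˡ (*-congˡ (h-factor N)))
              (double-step ε-unit D-step D̄-step (F-odd N) (F̄-odd N) (F-even N) (F̄-even N) hF hF̄)
      , trans (*-congˡ (*-congˡ (trans (h-factor N) (solve 1 (λ s → con (+ 1) :+ s :* s := con (+ 1) :+ :- s :* :- s) refl s))))
              (double-step ε-unit (twist D̄-step) (untwist D-step) (twist (F̄-odd N)) (untwist (F-odd N)) (F̄-even N) (F-even N) hF̄ hF)
      where
      ε = (- y) ^ suc N
      s = q * (- y) ^ N
      twist : ∀ {a b c s} → a ≈ b - s * c → a ≈ b + - s * c
      twist {a} {b} {c} {s} h = trans h (solve 3 (λ b s c → b :- s :* c := b :+ :- s :* c) refl b s c)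
      untwist : ∀ {a b c s} → a ≈ b + s * c → a ≈ b - - s * c
      untwist {a} {b} {c} {s} h = trans h (solve 3 (λ b s c → b :+ s :* c := b :- :- s :* c) refl b s c)
      D-step : d q y (suc N) m ≈ d q y N m + ε * d (- q) y (suc N) m + s * d (- q) y N m
      D-step = d-step refl N
      D̄-step : d (- q) y (suc N) m ≈ d (- q) y N m + ε * d q y (suc N) m - s * d q y N m
      D̄-step = trans (d-step (solve 1 (λ q → q := :- :- q) refl q) N)
                     (+-congˡ (solve 3 (λ q z D → :- q :* z :* D := :- (q :* z :* D)) refl q ((- y) ^ N) (d q y N m)))
      ε-unit : Unit (1# - ε * ε)
      ε-unit = 1-nilpotent-unit (*-nilpotent ε (*-nilpotent ((- y) ^ N) (m , neg-^-zero y m y^m≈0)))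

    -- Stanley's product, at the specialisation where a partition is weighted by
    -- (-1)^((O(λ) - O(λ′)) / 2).
    stanley : ∀ N → m ℕ.< N → F (N ℕ.* 2) * h m * poch (- y) (- y) m ≈ poch (- q) y m
    stanley (suc N) (ℕ.s≤s m≤N) = begin
      F (suc N ℕ.* 2) * h m * poch (- y) (- y) m            ≈⟨ *-congʳ (*-congˡ (poch-stable (- y) (*-^-zero y y m y^m≈0) (suc N) (ℕₚ.m≤n⇒m≤1+n m≤N))) ⟨
      F (suc N ℕ.* 2) * h (suc N) * poch (- y) (- y) m      ≈⟨ *-congʳ (proj₁ (F-closed (suc N))) ⟩
      d q y (suc N) m * poch (- y) (- y) m                  ≈⟨ *-congʳ (d-stable-K q (suc N) m ℕₚ.≤-refl) ⟨
      d q y (suc N) (suc m) * poch (- y) (- y) m            ≈⟨ d-product q N m m≤N ⟩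
      poch (- q) y (suc m)                                  ≈⟨ poch-stable (- q) y^m≈0 (suc m) (ℕₚ.n≤1+n m) ⟩
      poch (- q) y m                                        ∎

    E : ℕ → Carrier
    E k = poch (q ^ k) (q ^ k) m

    poch-E : ∀ k {z} → z ≈ q ^ k → poch z z m ≈ E k
    poch-E k z≈q^k = poch-cong z≈q^k z≈q^k m

    -- Theta quotients in terms of the products (qᵏ; qᵏ)

    module _ (P : Carrier) (N : ℕ) (m<N : m ℕ.< N) (PE₁≈1 : P * E 1 ≈ 1#) where

      e₁ e₂ e₄ e₈ e₁₆ e₃₂ O O₁ f θ θ′ ψ ē : Carrier
      e₁ = E 1
      e₂ = E 2
      e₄ = E 4
      e₈ = E 8
      e₁₆ = E 16
      e₃₂ = E 32
      O = poch (- y) (y * y) m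
      O₁ = poch (- q) y m
      ē = poch (- y) (- y) m
      f = F (N ℕ.* 2)
      -- The length is dictated by `ψ`: its m pairs and constant term use 2m + 1 odd squares, hence
      -- twice as many terms of `theta`.
      θ = theta y (suc (m ℕ.* 2) ℕ.* 2)
      θ′ = theta (- y) (suc (m ℕ.* 2) ℕ.* 2)
      ψ = psi (y ^ 8) m

      q^1≈ : q ≈ q ^ 1
      q^1≈ = sym (*-identityʳ q)
      q^2≈ : y ≈ q ^ 2
      q^2≈ = *-congˡ q^1≈
      q^4≈ : y * y ≈ q ^ 4
      q^4≈ = trans (*-cong q^2≈ q^2≈) (sym (^-homo-* q 2 2))
      q^8≈ : y * y * (y * y) ≈ q ^ 8
      q^8≈ = trans (*-cong q^4≈ q^4≈) (sym (^-homo-* q 4 4))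
      q^16≈ : y ^ 8 ≈ q ^ 16
      q^16≈ = trans (^-congˡ 8 q^2≈) (^-assocʳ q 2 8)
      q^32≈ : y ^ 8 * y ^ 8 ≈ q ^ 32
      q^32≈ = trans (*-cong q^16≈ q^16≈) (sym (^-homo-* q 16 16))

      m≤length : m ℕ.≤ suc (m ℕ.* 2) ℕ.* 2
      m≤length = ℕₚ.≤-trans (ℕₚ.m≤m*n m 2) (ℕₚ.≤-trans (ℕₚ.n≤1+n _) (ℕₚ.m≤m*n (suc (m ℕ.* 2)) 2))

      ē-split : ē ≈ O * e₄
      ē-split = begin
        ē                                                                    ≈⟨ poch-odd-even (- y) m (neg-^-zero y m y^m≈0) ⟩
        poch (- y) (- y * - y) m * poch (- y * - y) (- y * - y) m            ≈⟨ *-cong (poch-cong refl -y² m) (poch-E 4 (trans -y² q^4≈)) ⟩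
        O * e₄                                                               ∎
        where
        -y² : - y * - y ≈ y * y
        -y² = solve 1 (λ y → :- y :* :- y := y :* y) refl y

      f-product : f * O * ē ≈ O₁
      f-product = stanley N m<N

      O-product : O * e₂ * e₈ ≈ e₄ * e₄
      O-product = begin
        O * e₂ * e₈                                                          ≈⟨ *-cong (*-congˡ (poch-E 2 q^2≈)) (poch-E 8 q^8≈) ⟨
        O * poch y y m * poch (y * y * (y * y)) (y * y * (y * y)) m          ≈⟨ poch-odd-plus y m y^m≈0 ⟩
        poch (y * y) (y * y) m * poch (y * y) (y * y) m                      ≈⟨ *-cong (poch-E 4 q^4≈) (poch-E 4 q^4≈) ⟩
        e₄ * e₄                                                              ∎

      O₁-product : O₁ * e₁ * e₄ ≈ e₂ * e₂
      O₁-product = begin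
        O₁ * e₁ * e₄                                         ≈⟨ *-cong (*-congˡ (poch-E 1 q^1≈)) (poch-E 4 q^4≈) ⟨
        O₁ * poch q q m * poch (y * y) (y * y) m             ≈⟨ poch-odd-plus q m q^m≈0 ⟩
        poch y y m * poch y y m                              ≈⟨ *-cong (poch-E 2 q^2≈) (poch-E 2 q^2≈) ⟩
        e₂ * e₂                                              ∎

      θ-product : θ * e₄ ≈ e₂ * e₂
      θ-product = begin
        θ * e₄                           ≈⟨ *-congˡ (poch-E 4 q^4≈) ⟨
        θ * poch (y * y) (y * y) m       ≈⟨ theta-square y m _ y^m≈0 m≤length ⟩
        poch y y m * poch y y m          ≈⟨ *-cong (poch-E 2 q^2≈) (poch-E 2 q^2≈) ⟩
        e₂ * e₂                          ∎

      θ′-product : θ′ * e₄ ≈ ē * ē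
      θ′-product = trans (*-congˡ (sym (poch-E 4 (trans (solve 1 (λ y → :- y :* :- y := y :* y) refl y) q^4≈))))
                         (theta-square (- y) m _ (neg-^-zero y m y^m≈0) m≤length)

      ψ-product : ψ * e₁₆ ≈ e₃₂ * e₃₂
      ψ-product = begin
        ψ * e₁₆                                ≈⟨ *-congˡ (poch-E 16 q^16≈) ⟨
        ψ * poch (y ^ 8) (y ^ 8) m             ≈⟨ psi-square (y ^ 8) m (*-^-zero y (y ^ 7) m y^m≈0) ⟩
        poch (y ^ 8 * y ^ 8) (y ^ 8 * y ^ 8) m * poch (y ^ 8 * y ^ 8) (y ^ 8 * y ^ 8) m    ≈⟨ *-cong (poch-E 32 q^32≈) (poch-E 32 q^32≈) ⟩
        e₃₂ * e₃₂                              ∎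

      θ′-θ : θ′ ≈ θ + (1# + 1# + 1# + 1#) * (y * ψ)
      θ′-θ = trans (theta-odd-part y (suc (m ℕ.* 2))) (+-congˡ (*-congˡ (odd-squares-psi y m)))

      e₄-unit : Unit e₄
      e₄-unit = poch-unit (m , *-^-zero q (q ^ 3) m q^m≈0) m

      e₂²e₈² : Carrier
      e₂²e₈² = e₂ * e₂ * (e₈ * e₈)

      e₄⁴ : e₄ * e₄ * (e₄ * e₄) ≈ O * O * e₂²e₈²
      e₄⁴ = trans (*-cong (sym O-product) (sym O-product)) (solve 3 (λ O a b → O :* a :* b :* (O :* a :* b) := O :* O :* (a :* a :* (b :* b))) refl O e₂ e₈)

      -- This is φ(q²) = e₄⁵ / (e₂² e₈²), the origin of the fifth power in the theorem. It comes
      -- from φ(q²) e₄ = ē², with ē = O e₄ and O = e₄² / (e₂ e₈).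
      e₄⁵ : e₄ * e₄ * (e₄ * e₄) * e₄ ≈ e₂²e₈² * θ′
      e₄⁵ = unit-cancelʳ e₄-unit (begin
        e₄ * e₄ * (e₄ * e₄) * e₄ * e₄         ≈⟨ *-congʳ (*-congʳ e₄⁴) ⟩
        O * O * e₂²e₈² * e₄ * e₄              ≈⟨ solve 3 (λ O c e → O :* O :* c :* e :* e := c :* (O :* e :* (O :* e))) refl O e₂²e₈² e₄ ⟩
        e₂²e₈² * (O * e₄ * (O * e₄))          ≈⟨ *-congˡ (*-cong ē-split ē-split) ⟨
        e₂²e₈² * (ē * ē)                      ≈⟨ *-congˡ θ′-product ⟨
        e₂²e₈² * (θ′ * e₄)                    ≈⟨ *-assoc _ _ _ ⟨
        e₂²e₈² * θ′ * e₄                      ∎)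

      -- This is f e₁ = θ / θ′ with the denominator θ′ cleared by `e₄⁵`.
      f-e₁-e₄⁵ : f * e₁ * (e₄ * e₄ * (e₄ * e₄) * e₄) ≈ e₂²e₈² * θ
      f-e₁-e₄⁵ = unit-cancelʳ e₄-unit (begin
        f * e₁ * (e₄ * e₄ * (e₄ * e₄) * e₄) * e₄       ≈⟨ *-congʳ (*-congˡ (*-congʳ e₄⁴)) ⟩
        f * e₁ * (O * O * e₂²e₈² * e₄) * e₄            ≈⟨ solve 5 (λ f a O c e → f :* a :* (O :* O :* c :* e) :* e := c :* (f :* O :* (O :* e) :* a :* e)) refl f e₁ O e₂²e₈² e₄ ⟩
        e₂²e₈² * (f * O * (O * e₄) * e₁ * e₄)          ≈⟨ *-congˡ (*-congʳ (*-congʳ (trans (*-congˡ (sym ē-split)) f-product))) ⟩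
        e₂²e₈² * (O₁ * e₁ * e₄)                        ≈⟨ *-congˡ (trans O₁-product (sym θ-product)) ⟩
        e₂²e₈² * (θ * e₄)                              ≈⟨ *-assoc _ _ _ ⟨
        e₂²e₈² * θ * e₄                                ∎)

      -- Multiplication by e₁ e₄⁵ turns P into e₂² e₈² θ′ and f into e₂² e₈² θ, whose difference is
      -- 4 y ψ e₂² e₈²; the factor e₁₆ converts ψ into e₃₂².
      difference-product : (P - f) * (E 1 * E 4 ^ 5 * E 16) ≈ (1# + 1#) * ((1# + 1#) * (q ^ 2 * (E 2 ^ 2 * E 8 ^ 2 * E 32 ^ 2)))
      difference-product = begin
        (P - f) * (e₁ * e₄ ^ 5 * e₁₆)                                  ≈⟨ solve 5 (λ P f a e g → (P :- f) :* (a :* (e :* (e :* (e :* (e :* (e :* con (+ 1)))))) :* g)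
                                                                              := (P :* a :* (e :* e :* (e :* e) :* e) :- f :* a :* (e :* e :* (e :* e) :* e)) :* g) refl P f e₁ e₄ e₁₆ ⟩
        (P * e₁ * e⁵ - f * e₁ * e⁵) * e₁₆                              ≈⟨ *-congʳ (+-cong (*-cong PE₁≈1 e₄⁵) (-‿cong f-e₁-e₄⁵)) ⟩
        (1# * (e₂²e₈² * θ′) - e₂²e₈² * θ) * e₁₆                        ≈⟨ *-congʳ (+-congʳ (*-congˡ (*-congˡ θ′-θ))) ⟩
        (1# * (e₂²e₈² * (θ + (1# + 1# + 1# + 1#) * (y * ψ))) - e₂²e₈² * θ) * e₁₆
                                                                       ≈⟨ solve 5 (λ c t y p g → (con (+ 1) :* (c :* (t :+ con (+ 4) :* (y :* p))) :- c :* t) :* g := con (+ 2) :* (con (+ 2) :* (y :* (c :* (p :* g))))) refl e₂²e₈² θ y ψ e₁₆ ⟩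
        (1# + 1#) * ((1# + 1#) * (y * (e₂²e₈² * (ψ * e₁₆))))           ≈⟨ *-congˡ (*-congˡ (*-cong q^2≈ (*-congˡ ψ-product))) ⟩
        (1# + 1#) * ((1# + 1#) * (q ^ 2 * (e₂²e₈² * (e₃₂ * e₃₂))))     ≈⟨ *-congˡ (*-congˡ (*-congˡ (solve 3 (λ a b c → a :* a :* (b :* b) :* (c :* c) := a :* (a :* con (+ 1)) :* (b :* (b :* con (+ 1))) :* (c :* (c :* con (+ 1)))) refl e₂ e₈ e₃₂))) ⟩
        (1# + 1#) * ((1# + 1#) * (q ^ 2 * (E 2 ^ 2 * E 8 ^ 2 * E 32 ^ 2)))  ∎
        where e⁵ = e₄ * e₄ * (e₄ * e₄) * e₄

      module _ {Q₂ Q₈ Q₃₂ I₁ I₄ I₁₆ : Carrier}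
               (Q₂≈ : Q₂ ≈ E 2) (Q₈≈ : Q₈ ≈ E 8) (Q₃₂≈ : Q₃₂ ≈ E 32)
               (E₁I₁≈1 : E 1 * I₁ ≈ 1#) (E₄I₄≈1 : E 4 * I₄ ≈ 1#) (E₁₆I₁₆≈1 : E 16 * I₁₆ ≈ 1#) where

        quotient : Carrier
        quotient = Q₂ ^ 2 * Q₈ ^ 2 * Q₃₂ ^ 2 * I₁ * I₄ ^ 5 * I₁₆

        inverses : (E 1 * E 4 ^ 5 * E 16) * (I₁ * I₄ ^ 5 * I₁₆) ≈ 1#
        inverses = begin
          E 1 * E 4 ^ 5 * E 16 * (I₁ * I₄ ^ 5 * I₁₆)           ≈⟨ solve 6 (λ a b c d e f → a :* b :* c :* (d :* e :* f) := (a :* d) :* (b :* e) :* (c :* f)) refl (E 1) (E 4 ^ 5) (E 16) I₁ (I₄ ^ 5) I₁₆ ⟩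
          (E 1 * I₁) * (E 4 ^ 5 * I₄ ^ 5) * (E 16 * I₁₆)       ≈⟨ *-cong (*-cong E₁I₁≈1 (trans (sym (^-distrib-* (E 4) I₄ 5)) (^-congˡ 5 E₄I₄≈1))) E₁₆I₁₆≈1 ⟩
          1# * 1# ^ 5 * 1#                                     ≈⟨ solve 0 (con (+ 1) :* (con (+ 1) :* (con (+ 1) :* (con (+ 1) :* (con (+ 1) :* (con (+ 1) :* con (+ 1)))))) :* con (+ 1) := con (+ 1)) refl ⟩
          1#                                                   ∎

        -- The multiple 4r is written as a sum because addition of series is pointwise, so a
        -- coefficient can be read off without expanding a convolution with a constant.
        difference-quotient : let r = q ^ 2 * quotient in P - f ≈ (r + r) + (r + r)
        difference-quotient = begin
          P - f                                                ≈⟨ *-identityʳ _ ⟨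
          (P - f) * 1#                                         ≈⟨ *-congˡ inverses ⟨
          (P - f) * ((E 1 * E 4 ^ 5 * E 16) * (I₁ * I₄ ^ 5 * I₁₆))      ≈⟨ *-assoc _ _ _ ⟨
          (P - f) * (E 1 * E 4 ^ 5 * E 16) * (I₁ * I₄ ^ 5 * I₁₆)        ≈⟨ *-congʳ difference-product ⟩
          (1# + 1#) * ((1# + 1#) * (q ^ 2 * (E 2 ^ 2 * E 8 ^ 2 * E 32 ^ 2))) * (I₁ * I₄ ^ 5 * I₁₆)
            ≈⟨ *-congʳ (*-congˡ (*-congˡ (*-congˡ (*-cong (*-cong (^-congˡ 2 Q₂≈) (^-congˡ 2 Q₈≈)) (^-congˡ 2 Q₃₂≈))))) ⟨
          (1# + 1#) * ((1# + 1#) * (q ^ 2 * (Q₂ ^ 2 * Q₈ ^ 2 * Q₃₂ ^ 2))) * (I₁ * I₄ ^ 5 * I₁₆)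
            ≈⟨ solve 5 (λ x a b c d → con (+ 2) :* (con (+ 2) :* (x :* a)) :* (b :* c :* d) := let r = x :* (a :* b :* c :* d) in (r :+ r) :+ (r :+ r)) refl (q ^ 2) (Q₂ ^ 2 * Q₈ ^ 2 * Q₃₂ ^ 2) I₁ (I₄ ^ 5) I₁₆ ⟩
          (q ^ 2 * quotient + q ^ 2 * quotient) + (q ^ 2 * quotient + q ^ 2 * quotient)  ∎

open ≡ using (refl; sym; trans; cong; cong₂; subst; module ≡-Reasoning)

-- The sign of a partition and the residues modulo 4

module PartitionSigns where

  open ≡-Reasoning

  sign : ℕ → ℤ
  sign zero    = + 1
  sign (suc n) = ℤ.- sign n

  sign-+ : ∀ m n → sign (m ℕ.+ n) ≡ sign m ℤ.* sign n
  sign-+ zero    n = sym (ℤₚ.*-identityˡ (sign n))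
  sign-+ (suc m) n = trans (cong ℤ.-_ (sign-+ m n)) (ℤₚ.neg-distribˡ-* (sign m) (sign n))

  %2≢1⇒%2≡0 : ∀ x → x ℕ.% 2 ≢ 1 → x ℕ.% 2 ≡ 0
  %2≢1⇒%2≡0 zero          h = refl
  %2≢1⇒%2≡0 (suc zero)    h = contradiction refl h
  %2≢1⇒%2≡0 (suc (suc x)) h = %2≢1⇒%2≡0 x h

  oddParts-∷ : ∀ x l → oddParts (x ∷ l) ≡ x ℕ.% 2 ℕ.+ oddParts l
  oddParts-∷ x l with x ℕ.% 2 ≟ 1
  ... | yes odd = trans (cong length (filter-accept (λ x → x ℕ.% 2 ≟ 1) {x} {l} odd)) (cong (ℕ._+ oddParts l) (sym odd))
  ... | no ¬odd = trans (cong length (filter-reject (λ x → x ℕ.% 2 ≟ 1) {x} {l} ¬odd)) (cong (ℕ._+ oddParts l) (sym (%2≢1⇒%2≡0 x ¬odd)))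

  parity-suc : ∀ x → suc x ℕ.% 2 ℕ.+ x ℕ.% 2 ≡ 1
  parity-suc zero          = refl
  parity-suc (suc zero)    = refl
  parity-suc (suc (suc x)) = parity-suc x

  parity-half : ∀ x → x ≡ x ℕ.% 2 ℕ.+ 2 ℕ.* ⌊ x /2⌋
  parity-half zero          = refl
  parity-half (suc zero)    = refl
  parity-half (suc (suc x)) = trans (cong (λ y → suc (suc y)) (parity-half x)) (lemma (x ℕ.% 2) ⌊ x /2⌋)
    where
    lemma : ∀ a b → suc (suc (a ℕ.+ 2 ℕ.* b)) ≡ a ℕ.+ 2 ℕ.* suc b
    lemma = ℕ-Solver.solve-∀

  oddValues : (ℕ → ℕ) → ℕ → ℕ
  oddValues g n = oddParts (applyUpTo g n)

  oddValues-cong : ∀ {g h} n → (∀ i → i < n → g i ≡ h i) → oddValues g n ≡ oddValues h n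
  oddValues-cong zero    g≡h = refl
  oddValues-cong {g} {h} (suc n) g≡h = begin
    oddValues g (suc n)                          ≡⟨ oddParts-∷ (g 0) _ ⟩
    g 0 ℕ.% 2 ℕ.+ oddValues (g ∘ suc) n          ≡⟨ cong₂ (λ a b → a ℕ.% 2 ℕ.+ b) (g≡h 0 (s≤s z≤n)) (oddValues-cong n (λ i i<n → g≡h (suc i) (s≤s i<n))) ⟩
    h 0 ℕ.% 2 ℕ.+ oddValues (h ∘ suc) n          ≡⟨ oddParts-∷ (h 0) _ ⟨
    oddValues h (suc n)                          ∎

  oddValues-zero : ∀ g n → (∀ i → g i ≡ 0) → oddValues g n ≡ 0
  oddValues-zero g n g≡0 = trans (oddValues-cong n (λ i _ → g≡0 i)) (zeros n)
    where
    zeros : ∀ n → oddValues (λ _ → 0) n ≡ 0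
    zeros zero    = refl
    zeros (suc n) = zeros n

  -- Zero is even. Thus the columns of a partition may be counted over the full length of a longer
  -- row placed on top of it.
  oddValues-extend : ∀ g m n → m ≤ n → (∀ i → m ≤ i → g i ≡ 0) → oddValues g n ≡ oddValues g m
  oddValues-extend g zero    n       z≤n       g≡0 = oddValues-zero g n (λ i → g≡0 i z≤n)
  oddValues-extend g (suc m) (suc n) (s≤s m≤n) g≡0 = begin
    oddValues g (suc n)                          ≡⟨ oddParts-∷ (g 0) _ ⟩
    g 0 ℕ.% 2 ℕ.+ oddValues (g ∘ suc) n          ≡⟨ cong (g 0 ℕ.% 2 ℕ.+_) (oddValues-extend (g ∘ suc) m n m≤n (λ i m≤i → g≡0 (suc i) (s≤s m≤i))) ⟩
    g 0 ℕ.% 2 ℕ.+ oddValues (g ∘ suc) m          ≡⟨ oddParts-∷ (g 0) _ ⟨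
    oddValues g (suc m)                          ∎

  oddValues-suc : ∀ g n → oddValues (suc ∘ g) n ℕ.+ oddValues g n ≡ n
  oddValues-suc g zero    = refl
  oddValues-suc g (suc n) = begin
    oddValues (suc ∘ g) (suc n) ℕ.+ oddValues g (suc n)
      ≡⟨ cong₂ ℕ._+_ (oddParts-∷ (suc (g 0)) _) (oddParts-∷ (g 0) _) ⟩
    (suc (g 0) ℕ.% 2 ℕ.+ oddValues (suc ∘ g ∘ suc) n) ℕ.+ (g 0 ℕ.% 2 ℕ.+ oddValues (g ∘ suc) n)
      ≡⟨ +-interchange (suc (g 0) ℕ.% 2) (oddValues (suc ∘ g ∘ suc) n) (g 0 ℕ.% 2) (oddValues (g ∘ suc) n) ⟩
    (suc (g 0) ℕ.% 2 ℕ.+ g 0 ℕ.% 2) ℕ.+ (oddValues (suc ∘ g ∘ suc) n ℕ.+ oddValues (g ∘ suc) n)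
      ≡⟨ cong₂ ℕ._+_ (parity-suc (g 0)) (oddValues-suc (g ∘ suc) n) ⟩
    suc n                                        ∎
    where open import Algebra.Properties.CommutativeSemigroup ℕₚ.+-commutativeSemigroup using () renaming (interchange to +-interchange)

  column : List ℕ → ℕ → ℕ
  column l j = length (filter (λ x → suc j ≤? x) l)

  column-empty : ∀ l j → largest l ≤ j → column l j ≡ 0
  column-empty []      j _   = refl
  column-empty (x ∷ l) j l≤j = trans
    (cong length (filter-reject (λ x → suc j ≤? x) {x} {l} (λ j<x → ℕₚ.<⇒≱ j<x (ℕₚ.≤-trans (ℕₚ.m≤m⊔n x (largest l)) l≤j))))
    (column-empty l j (ℕₚ.≤-trans (ℕₚ.m≤n⊔m x (largest l)) l≤j))

  column-∷ : ∀ N l j → j < N → column (N ∷ l) j ≡ suc (column l j)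
  column-∷ N l j j<N = cong length (filter-accept (λ x → suc j ≤? x) {N} {l} j<N)

  oddColumns : List ℕ → ℕ
  oddColumns l = oddParts (conjugate l)

  oddColumns-column : ∀ l → oddColumns l ≡ oddValues (column l) (largest l)
  oddColumns-column l = cong oddParts (map-upTo (column l) (largest l))

  ∧-true : ∀ {a b} → (a ∧ b) ≡ true → a ≡ true × b ≡ true
  ∧-true {true} {true} refl = refl , refl

  ≤?-true : ∀ {m n} → ⌊ m ≤? n ⌋ ≡ true → m ≤ n
  ≤?-true {m} {n} h with m ≤? n
  ... | yes m≤n = m≤n
  ... | no _ with () ← h

  nonIncreasing-tail : ∀ N l → nonIncreasing (N ∷ l) ≡ true → nonIncreasing l ≡ true
  nonIncreasing-tail N []      h = refl
  nonIncreasing-tail N (x ∷ l) h = proj₂ (∧-true h)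

  nonIncreasing-largest : ∀ N l → nonIncreasing (N ∷ l) ≡ true → largest l ≤ N
  nonIncreasing-largest N []      h = z≤n
  nonIncreasing-largest N (x ∷ l) h with ∧-true h
  ... | x≤N , h′ = ℕₚ.⊔-lub (≤?-true x≤N) (ℕₚ.≤-trans (nonIncreasing-largest x l h′) (≤?-true x≤N))

  -- A new first row of length N flips the parity of each of the first N columns.
  oddColumns-∷ : ∀ N l → nonIncreasing (N ∷ l) ≡ true → oddColumns (N ∷ l) ℕ.+ oddColumns l ≡ N
  oddColumns-∷ N l h = begin
    oddColumns (N ∷ l) ℕ.+ oddColumns l                                   ≡⟨ cong₂ ℕ._+_ (oddColumns-column (N ∷ l)) (oddColumns-column l) ⟩
    oddValues (column (N ∷ l)) (N ⊔ largest l) ℕ.+ oddValues (column l) (largest l)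
      ≡⟨ cong₂ (λ a b → oddValues (column (N ∷ l)) a ℕ.+ b) (ℕₚ.m≥n⇒m⊔n≡m l≤N) (sym (oddValues-extend (column l) (largest l) N l≤N (column-empty l))) ⟩
    oddValues (column (N ∷ l)) N ℕ.+ oddValues (column l) N               ≡⟨ cong (ℕ._+ oddValues (column l) N) (oddValues-cong N (column-∷ N l)) ⟩
    oddValues (suc ∘ column l) N ℕ.+ oddValues (column l) N               ≡⟨ oddValues-suc (column l) N ⟩
    N                                                                     ∎
    where l≤N = nonIncreasing-largest N l h

  -- (-1)^exponent is the sign (-1)^((O(λ) - O(λ′)) / 2): by oddColumns-∷ a new first
  -- row N changes (O(λ) - O(λ′)) / 2 by O(λ′) - ⌊N/2⌋, and O(λ′) ≡ |λ| modulo 2.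
  exponent : List ℕ → ℕ
  exponent []      = 0
  exponent (N ∷ l) = (⌊ N /2⌋ ℕ.+ sum l) ℕ.+ exponent l

  -- The congruences modulo 2 and 4 carry integer witnesses, so that no case distinction on signs
  -- arises. The first one is kept because its double feeds the second when a row is added.
  record Congruences (l : List ℕ) : Set where
    field
      i j : ℤ
      columns-parity : + oddColumns l ≡ + sum l ℤ.+ + 2 ℤ.* i
      difference     : + oddParts l ℤ.+ + 2 ℤ.* + exponent l ≡ + oddColumns l ℤ.+ + 4 ℤ.* j

  congruences : ∀ l → nonIncreasing l ≡ true → Congruences l
  congruences []      h = record { i = + 0 ; j = + 0 ; columns-parity = refl ; difference = refl }
  congruences (N ∷ l) h = record
    { i = ℤ.- (+ sum l ℤ.+ i)
    ; j = j ℤ.+ + sum l ℤ.+ i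
    ; columns-parity = begin
        + oddColumns (N ∷ l)                                   ≡⟨ columns ⟩
        + N ℤ.- + oddColumns l                                 ≡⟨ cong (λ x → + N ℤ.- x) columns-parity ⟩
        + N ℤ.- (+ sum l ℤ.+ + 2 ℤ.* i)                        ≡⟨ identity₁ (+ N) (+ sum l) i ⟩
        (+ N ℤ.+ + sum l) ℤ.+ + 2 ℤ.* ℤ.- (+ sum l ℤ.+ i)      ∎
    ; difference = begin
        + oddParts (N ∷ l) ℤ.+ + 2 ℤ.* + exponent (N ∷ l)
          ≡⟨ cong (λ x → + x ℤ.+ + 2 ℤ.* + exponent (N ∷ l)) (oddParts-∷ N l) ⟩
        (+ (N ℕ.% 2) ℤ.+ + oddParts l) ℤ.+ + 2 ℤ.* ((+ ⌊ N /2⌋ ℤ.+ + sum l) ℤ.+ + exponent l)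
          ≡⟨ identity₂ (+ (N ℕ.% 2)) (+ oddParts l) (+ ⌊ N /2⌋) (+ sum l) (+ exponent l) ⟩
        (+ (N ℕ.% 2) ℤ.+ + 2 ℤ.* + ⌊ N /2⌋) ℤ.+ (+ oddParts l ℤ.+ + 2 ℤ.* + exponent l) ℤ.+ + 2 ℤ.* + sum l
          ≡⟨ cong₂ (λ a b → a ℤ.+ b ℤ.+ + 2 ℤ.* + sum l) half difference ⟩
        + N ℤ.+ (+ oddColumns l ℤ.+ + 4 ℤ.* j) ℤ.+ + 2 ℤ.* + sum l
          -- O(λ′) is split as -O(λ′) + 2 O(λ′): the first part combines with N into the new number
          -- of odd columns, and in the second the factor 2 makes knowledge of O(λ′) modulo 2
          -- sufficient.
          ≡⟨ identity₃ (+ N) (+ oddColumns l) j (+ sum l) ⟩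
        (+ N ℤ.- + oddColumns l) ℤ.+ + 2 ℤ.* + oddColumns l ℤ.+ + 4 ℤ.* j ℤ.+ + 2 ℤ.* + sum l
          ≡⟨ cong₂ (λ a b → a ℤ.+ + 2 ℤ.* b ℤ.+ + 4 ℤ.* j ℤ.+ + 2 ℤ.* + sum l) (sym columns) columns-parity ⟩
        + oddColumns (N ∷ l) ℤ.+ + 2 ℤ.* (+ sum l ℤ.+ + 2 ℤ.* i) ℤ.+ + 4 ℤ.* j ℤ.+ + 2 ℤ.* + sum l
          ≡⟨ identity₄ (+ oddColumns (N ∷ l)) (+ sum l) i j ⟩
        + oddColumns (N ∷ l) ℤ.+ + 4 ℤ.* (j ℤ.+ + sum l ℤ.+ i)  ∎
    }
    where
    open Congruences (congruences l (nonIncreasing-tail N l h))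
    identity₀ : ∀ a b → a ≡ (a ℤ.+ b) ℤ.- b
    identity₀ = ℤ-Solver.solve-∀
    columns : + oddColumns (N ∷ l) ≡ + N ℤ.- + oddColumns l
    columns = trans (identity₀ (+ oddColumns (N ∷ l)) (+ oddColumns l)) (cong (λ x → + x ℤ.- + oddColumns l) (oddColumns-∷ N l h))
    half : + (N ℕ.% 2) ℤ.+ + 2 ℤ.* + ⌊ N /2⌋ ≡ + N
    half = trans (cong (λ x → + (N ℕ.% 2) ℤ.+ x) (sym (ℤₚ.pos-* 2 ⌊ N /2⌋))) (cong +_ (sym (parity-half N)))
    identity₁ : ∀ N s i → N ℤ.- (s ℤ.+ + 2 ℤ.* i) ≡ (N ℤ.+ s) ℤ.+ + 2 ℤ.* ℤ.- (s ℤ.+ i)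
    identity₁ = ℤ-Solver.solve-∀
    identity₂ : ∀ o a k s e → (o ℤ.+ a) ℤ.+ + 2 ℤ.* ((k ℤ.+ s) ℤ.+ e) ≡ (o ℤ.+ + 2 ℤ.* k) ℤ.+ (a ℤ.+ + 2 ℤ.* e) ℤ.+ + 2 ℤ.* s
    identity₂ = ℤ-Solver.solve-∀
    identity₃ : ∀ N b j s → N ℤ.+ (b ℤ.+ + 4 ℤ.* j) ℤ.+ + 2 ℤ.* s ≡ (N ℤ.- b) ℤ.+ + 2 ℤ.* b ℤ.+ + 4 ℤ.* j ℤ.+ + 2 ℤ.* s
    identity₃ = ℤ-Solver.solve-∀
    identity₄ : ∀ b s i j → b ℤ.+ + 2 ℤ.* (s ℤ.+ + 2 ℤ.* i) ℤ.+ + 4 ℤ.* j ℤ.+ + 2 ℤ.* s ≡ b ℤ.+ + 4 ℤ.* (j ℤ.+ s ℤ.+ i)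
    identity₄ = ℤ-Solver.solve-∀

  %4-cong : ∀ a b z → + a ≡ + b ℤ.+ + 4 ℤ.* z → a ℕ.% 4 ≡ b ℕ.% 4
  %4-cong a b (+ k) h = trans (cong (ℕ._% 4) a≡) (DivMod.[m+kn]%n≡m%n b k 4)
    where
    a≡ : a ≡ b ℕ.+ k ℕ.* 4
    a≡ = ℤₚ.+-injective (trans h (cong (λ x → + b ℤ.+ x) (trans (sym (ℤₚ.pos-* 4 k)) (cong +_ (ℕₚ.*-comm 4 k)))))
  %4-cong a b -[1+ k ] h = sym (%4-cong b a (+ suc k) (trans (identity (+ b) (+ suc k)) (cong (ℤ._+ + 4 ℤ.* + suc k) (sym h))))
    where
    identity : ∀ b k → b ≡ (b ℤ.+ + 4 ℤ.* ℤ.- k) ℤ.+ + 4 ℤ.* k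
    identity = ℤ-Solver.solve-∀

  2*-≢-1 : ∀ z → + 2 ℤ.* z ≢ + 1
  2*-≢-1 (+ k) h with ℤₚ.+-injective (trans (ℤₚ.pos-* 2 k) h)
  ... | eq = contradiction (trans (cong (ℕ._% 2) (trans (sym eq) (ℕₚ.*-comm 2 k))) (DivMod.m*n%n≡0 k 2)) λ ()
  2*-≢-1 -[1+ k ] ()

  %4-shift : ∀ a b z → + a ℤ.+ + 2 ≡ + b ℤ.+ + 4 ℤ.* z → a ℕ.% 4 ≢ b ℕ.% 4
  %4-shift a b z h same = 2*-≢-1 (z ℤ.+ + v ℤ.- + u′) (ℤₚ.*-cancelˡ-≡ (+ 2) _ _ (begin
    + 2 ℤ.* (+ 2 ℤ.* (z ℤ.+ + v ℤ.- + u′))                                             ≡⟨ identity (+ r) z (+ v) (+ u′) ⟩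
    ((+ r ℤ.+ + v ℤ.* + 4) ℤ.+ + 4 ℤ.* z) ℤ.- (+ r ℤ.+ + u′ ℤ.* + 4)                   ≡⟨ cong₂ (λ x y → (x ℤ.+ + 4 ℤ.* z) ℤ.- y) (sym (trans (divide b) (cong (λ x → + x ℤ.+ + v ℤ.* + 4) (sym same)))) (sym (divide a)) ⟩
    (+ b ℤ.+ + 4 ℤ.* z) ℤ.- + a                                                        ≡⟨ cong (ℤ._- + a) (sym h) ⟩
    (+ a ℤ.+ + 2) ℤ.- + a                                                              ≡⟨ identity′ (+ a) ⟩
    + 2 ℤ.* + 1                                                                        ∎))
    where
    r = a ℕ.% 4
    u′ = a ℕ./ 4
    v = b ℕ./ 4
    divide : ∀ a → + a ≡ + (a ℕ.% 4) ℤ.+ + (a ℕ./ 4) ℤ.* + 4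
    divide a = trans (cong +_ (DivMod.m≡m%n+[m/n]*n a 4)) (cong (λ x → + (a ℕ.% 4) ℤ.+ x) (ℤₚ.pos-* (a ℕ./ 4) 4))
    identity : ∀ r z v u → + 2 ℤ.* (+ 2 ℤ.* (z ℤ.+ v ℤ.- u)) ≡ ((r ℤ.+ v ℤ.* + 4) ℤ.+ + 4 ℤ.* z) ℤ.- (r ℤ.+ u ℤ.* + 4)
    identity = ℤ-Solver.solve-∀
    identity′ : ∀ a → (a ℤ.+ + 2) ℤ.- a ≡ + 2 ℤ.* + 1
    identity′ = ℤ-Solver.solve-∀

  -- As 2e ≡ b - a modulo 4, the parity of e decides whether the residues agree. Lowering e by 2
  -- keeps the sign and is absorbed by lowering j by 1.
  sign-mod-4 : ∀ a b e j → + a ℤ.+ + 2 ℤ.* + e ≡ + b ℤ.+ + 4 ℤ.* j →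
               sign e ≡ (if ⌊ a ℕ.% 4 ≟ b ℕ.% 4 ⌋ then + 1 else ℤ.- + 1)
  sign-mod-4 a b zero j h with a ℕ.% 4 ≟ b ℕ.% 4
  ... | yes _  = refl
  ... | no neq = contradiction (%4-cong a b j (trans (sym (ℤₚ.+-identityʳ (+ a))) h)) neq
  sign-mod-4 a b (suc zero) j h with a ℕ.% 4 ≟ b ℕ.% 4
  ... | yes eq = contradiction eq (%4-shift a b j h)
  ... | no _   = refl
  sign-mod-4 a b (suc (suc e)) j h = trans (ℤₚ.neg-involutive (sign e)) (sign-mod-4 a b e (j ℤ.- + 1) (begin
    + a ℤ.+ + 2 ℤ.* + e                                ≡⟨ identity (+ a) (+ e) ⟩
    (+ a ℤ.+ + 2 ℤ.* (+ 2 ℤ.+ + e)) ℤ.- + 4            ≡⟨ cong (ℤ._- + 4) h ⟩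
    (+ b ℤ.+ + 4 ℤ.* j) ℤ.- + 4                        ≡⟨ identity′ (+ b) j ⟩
    + b ℤ.+ + 4 ℤ.* (j ℤ.- + 1)                        ∎))
    where
    identity : ∀ a e → a ℤ.+ + 2 ℤ.* e ≡ (a ℤ.+ + 2 ℤ.* (+ 2 ℤ.+ e)) ℤ.- + 4
    identity = ℤ-Solver.solve-∀
    identity′ : ∀ b j → (b ℤ.+ + 4 ℤ.* j) ℤ.- + 4 ≡ b ℤ.+ + 4 ℤ.* (j ℤ.- + 1)
    identity′ = ℤ-Solver.solve-∀

  sign-sameMod4 : ∀ l → nonIncreasing l ≡ true → sign (exponent l) ≡ (if sameMod4 l then + 1 else ℤ.- + 1)
  sign-sameMod4 l h = sign-mod-4 (oddParts l) (oddColumns l) (exponent l) j difference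
    where open Congruences (congruences l h)

-- Weighted counts of partitions with bounded parts

module PartitionCounts where

  open ≡-Reasoning
  open PartitionSigns

  delay : ℕ → Series → Series
  delay zero    f n       = f n
  delay (suc k) f zero    = + 0
  delay (suc k) f (suc n) = delay k f n

  total : ∀ {A : Set} → (A → ℤ) → List A → ℤ
  total g []       = + 0
  total g (x ∷ xs) = g x ℤ.+ total g xs

  total-++ : ∀ {A : Set} (g : A → ℤ) xs ys → total g (xs ++ ys) ≡ total g xs ℤ.+ total g ys
  total-++ g []       ys = sym (ℤₚ.+-identityˡ _)
  total-++ g (x ∷ xs) ys = trans (cong (λ z → g x ℤ.+ z) (total-++ g xs ys)) (sym (ℤₚ.+-assoc (g x) _ _))

  total-concatMap : ∀ {A B : Set} (g : B → ℤ) (F : A → List B) xs → total g (concatMap F xs) ≡ total (λ x → total g (F x)) xs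
  total-concatMap g F []       = refl
  total-concatMap g F (x ∷ xs) = trans (total-++ g (F x) (concatMap F xs)) (cong (λ z → total g (F x) ℤ.+ z) (total-concatMap g F xs))

  total-map : ∀ {A B : Set} (g : B → ℤ) (h : A → B) xs → total g (map h xs) ≡ total (g ∘ h) xs
  total-map g h []       = refl
  total-map g h (x ∷ xs) = cong (λ z → g (h x) ℤ.+ z) (total-map g h xs)

  total-cong : ∀ {A : Set} {g h : A → ℤ} {xs} → All (λ x → g x ≡ h x) xs → total g xs ≡ total h xs
  total-cong []         = refl
  total-cong (eq ∷ eqs) = cong₂ ℤ._+_ eq (total-cong eqs)

  total-*ˡ : ∀ {A : Set} c (g : A → ℤ) xs → total (λ x → c ℤ.* g x) xs ≡ c ℤ.* total g xs
  total-*ˡ c g []       = sym (ℤₚ.*-zeroʳ c)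
  total-*ˡ c g (x ∷ xs) = trans (cong (λ z → c ℤ.* g x ℤ.+ z) (total-*ˡ c g xs)) (sym (ℤₚ.*-distribˡ-+ c (g x) (total g xs)))

  total-0 : ∀ {A : Set} (xs : List A) → total (λ _ → + 0) xs ≡ + 0
  total-0 []       = refl
  total-0 (x ∷ xs) = trans (ℤₚ.+-identityˡ _) (total-0 xs)

  compositionsF-sum : ∀ f n → All (λ l → sum l ≡ n) (compositionsF f n)
  compositionsF-sum zero    zero    = refl ∷ []
  compositionsF-sum (suc f) zero    = refl ∷ []
  compositionsF-sum zero    (suc n) = []
  compositionsF-sum (suc f) (suc n) = Allₚ.concat⁺ (Allₚ.map⁺ (Allₚ.applyUpTo⁺₁ id (suc n) λ {k} k<1+n →
    Allₚ.map⁺ (All.map (λ {l} eq → cong suc (trans (cong (k ℕ.+_) eq) (ℕₚ.m+[n∸m]≡n (ℕₚ.≤-pred k<1+n)))) (compositionsF-sum f (n ∸ k)))))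

  -- Σ_{k < min(N, n + 1)} h k (n - k)
  antidiagonal : ℕ → (ℕ → Series) → Series
  antidiagonal zero    h n       = + 0
  antidiagonal (suc N) h zero    = h 0 0
  antidiagonal (suc N) h (suc n) = h 0 (suc n) ℤ.+ antidiagonal N (h ∘ suc) n

  antidiagonal-suc : ∀ N h n → antidiagonal (suc N) h n ≡ antidiagonal N h n ℤ.+ delay N (h N) n
  antidiagonal-suc zero    h zero    = sym (ℤₚ.+-identityˡ _)
  antidiagonal-suc zero    h (suc n) = trans (ℤₚ.+-identityʳ (h 0 (suc n))) (sym (ℤₚ.+-identityˡ (h 0 (suc n))))
  antidiagonal-suc (suc N) h zero    = sym (ℤₚ.+-identityʳ _)
  antidiagonal-suc (suc N) h (suc n) = trans (cong (λ z → h 0 (suc n) ℤ.+ z) (antidiagonal-suc N (h ∘ suc) n)) (sym (ℤₚ.+-assoc (h 0 (suc n)) _ _))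

  antidiagonal-cong : ∀ N {h h′} n → (∀ k m → m ≤ n → h k m ≡ h′ k m) → antidiagonal N h n ≡ antidiagonal N h′ n
  antidiagonal-cong zero    n       eq = refl
  antidiagonal-cong (suc N) zero    eq = eq 0 0 z≤n
  antidiagonal-cong (suc N) (suc n) eq = cong₂ ℤ._+_ (eq 0 (suc n) ℕₚ.≤-refl) (antidiagonal-cong N n (λ k m m≤n → eq (suc k) m (ℕₚ.m≤n⇒m≤1+n m≤n)))

  ≤?-suc : ∀ m n → ⌊ suc m ≤? suc n ⌋ ≡ ⌊ m ≤? n ⌋
  ≤?-suc m n with m ≤? n | suc m ≤? suc n
  ... | yes _   | yes _   = refl
  ... | no _    | no _    = refl
  ... | yes m≤n | no h    = contradiction (s≤s m≤n) h
  ... | no h    | yes m≤n = contradiction (ℕₚ.≤-pred m≤n) h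

  total-antidiagonal : ∀ N h n → total (λ k → if ⌊ suc k ≤? N ⌋ then h k (n ∸ k) else + 0) (upTo (suc n)) ≡ antidiagonal N h n
  total-antidiagonal N h n = trans (sym (total-applyUpTo (λ k → if ⌊ suc k ≤? N ⌋ then h k (n ∸ k) else + 0) id (suc n))) (main N h n)
    where
    total-applyUpTo : ∀ {A : Set} (g : A → ℤ) (e : ℕ → A) n → total id (applyUpTo (g ∘ e) n) ≡ total g (applyUpTo e n)
    total-applyUpTo g e zero    = refl
    total-applyUpTo g e (suc n) = cong (λ z → g (e 0) ℤ.+ z) (total-applyUpTo g (e ∘ suc) n)

    zeros : ∀ n → total id (applyUpTo (λ _ → + 0) n) ≡ + 0
    zeros zero    = refl
    zeros (suc n) = trans (ℤₚ.+-identityˡ _) (zeros n)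

    applyUpTo-cong : ∀ {g h : ℕ → ℤ} → (∀ k → g k ≡ h k) → ∀ n → total id (applyUpTo g n) ≡ total id (applyUpTo h n)
    applyUpTo-cong eq zero    = refl
    applyUpTo-cong eq (suc n) = cong₂ ℤ._+_ (eq 0) (applyUpTo-cong (eq ∘ suc) n)

    main : ∀ N h n → total id (applyUpTo (λ k → if ⌊ suc k ≤? N ⌋ then h k (n ∸ k) else + 0) (suc n)) ≡ antidiagonal N h n
    main zero    h n       = zeros (suc n)
    main (suc N) h zero    = ℤₚ.+-identityʳ _
    main (suc N) h (suc n) = cong (λ z → h 0 (suc n) ℤ.+ z) (trans
      (applyUpTo-cong (λ k → cong (λ b → if b then h (suc k) (n ∸ k) else + 0) (≤?-suc (suc k) N)) (suc n))
      (main N (h ∘ suc) n))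

  nonIncreasing-∷ : ∀ N l → sum l ≤ N → nonIncreasing (N ∷ l) ≡ nonIncreasing l
  nonIncreasing-∷ N []      h = refl
  nonIncreasing-∷ N (x ∷ l) h with x ≤? N
  ... | yes _  = refl
  ... | no x≰N = contradiction (ℕₚ.≤-trans (ℕₚ.m≤m+n x (sum l)) h) x≰N

  -- A weight that is a product over the rows, where each factor sees only the row and the size of
  -- what lies below it. Both the constant weight and the sign have this form, and dependence on the
  -- size alone is what makes the recurrence close on generating functions: a factor (-1)^size
  -- amounts to q ↦ -q.
  module Weighted (κ : ℕ → ℕ → ℤ) where

    weight : List ℕ → ℤ
    weight []      = + 1
    weight (N ∷ l) = κ N (sum l) ℤ.* weight l

    -- Prepending N to l tests both that l is non-increasing and that its parts are ≤ N.
    boundedWeight : ℕ → List ℕ → ℤ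
    boundedWeight N l = if nonIncreasing (N ∷ l) then weight l else + 0

    countF : ℕ → ℕ → ℕ → ℤ
    countF f N n = total (boundedWeight N) (compositionsF f n)

    count : ℕ → Series
    count N n = countF n N n

    boundedWeight-∷ : ∀ N k m l → sum l ≡ m → boundedWeight N (suc k ∷ l) ≡ (if ⌊ suc k ≤? N ⌋ then κ (suc k) m ℤ.* boundedWeight (suc k) l else + 0)
    boundedWeight-∷ N k m l refl with ⌊ suc k ≤? N ⌋
    ... | false = refl
    ... | true with nonIncreasing (suc k ∷ l)
    ...   | true  = refl
    ...   | false = sym (ℤₚ.*-zeroʳ (κ (suc k) (sum l)))

    countF-suc : ∀ f N n → countF (suc f) N (suc n) ≡ antidiagonal N (λ k m → κ (suc k) m ℤ.* countF f (suc k) m) n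
    countF-suc f N n = begin
      total (boundedWeight N) (concatMap (λ k → map (suc k ∷_) (compositionsF f (n ∸ k))) (upTo (suc n)))
        ≡⟨ total-concatMap (boundedWeight N) (λ k → map (suc k ∷_) (compositionsF f (n ∸ k))) (upTo (suc n)) ⟩
      total (λ k → total (boundedWeight N) (map (suc k ∷_) (compositionsF f (n ∸ k)))) (upTo (suc n))
        ≡⟨ total-cong (All.universal (λ k → first-part k (n ∸ k)) (upTo (suc n))) ⟩
      total (λ k → if ⌊ suc k ≤? N ⌋ then κ (suc k) (n ∸ k) ℤ.* countF f (suc k) (n ∸ k) else + 0) (upTo (suc n))
        ≡⟨ total-antidiagonal N (λ k m → κ (suc k) m ℤ.* countF f (suc k) m) n ⟩
      antidiagonal N (λ k m → κ (suc k) m ℤ.* countF f (suc k) m) n ∎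
      where
      pull : ∀ b c m k → total (λ l → if b then c ℤ.* boundedWeight k l else + 0) (compositionsF f m) ≡ (if b then c ℤ.* countF f k m else + 0)
      pull true  c m k = total-*ˡ c (boundedWeight k) (compositionsF f m)
      pull false c m k = total-0 (compositionsF f m)

      first-part : ∀ k m → total (boundedWeight N) (map (suc k ∷_) (compositionsF f m)) ≡ (if ⌊ suc k ≤? N ⌋ then κ (suc k) m ℤ.* countF f (suc k) m else + 0)
      first-part k m = begin
        total (boundedWeight N) (map (suc k ∷_) (compositionsF f m))          ≡⟨ total-map (boundedWeight N) (suc k ∷_) (compositionsF f m) ⟩
        total (λ l → boundedWeight N (suc k ∷ l)) (compositionsF f m)         ≡⟨ total-cong (All.map (λ {l} eq → boundedWeight-∷ N k m l eq) (compositionsF-sum f m)) ⟩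
        total (λ l → if ⌊ suc k ≤? N ⌋ then κ (suc k) m ℤ.* boundedWeight (suc k) l else + 0) (compositionsF f m)
                                                                              ≡⟨ pull ⌊ suc k ≤? N ⌋ (κ (suc k) m) m (suc k) ⟩
        (if ⌊ suc k ≤? N ⌋ then κ (suc k) m ℤ.* countF f (suc k) m else + 0)  ∎

    -- After a first part k + 1 only n - k is left to compose, but the fuel has dropped by just one.
    -- Independence of the fuel turns the inner counts into values of `count`.
    countF-fuel : ∀ f g N n → n ≤ f → n ≤ g → countF f N n ≡ countF g N n
    countF-fuel zero    zero    N zero    n≤f       n≤g       = refl
    countF-fuel zero    (suc g) N zero    n≤f       n≤g       = refl
    countF-fuel (suc f) zero    N zero    n≤f       n≤g       = refl
    countF-fuel (suc f) (suc g) N zero    n≤f       n≤g       = refl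
    countF-fuel (suc f) (suc g) N (suc n) (s≤s n≤f) (s≤s n≤g) = begin
      countF (suc f) N (suc n)                                             ≡⟨ countF-suc f N n ⟩
      antidiagonal N (λ k m → κ (suc k) m ℤ.* countF f (suc k) m) n        ≡⟨ antidiagonal-cong N n (λ k m m≤n → cong (λ z → κ (suc k) m ℤ.* z) (countF-fuel f g (suc k) m (ℕₚ.≤-trans m≤n n≤f) (ℕₚ.≤-trans m≤n n≤g))) ⟩
      antidiagonal N (λ k m → κ (suc k) m ℤ.* countF g (suc k) m) n        ≡⟨ countF-suc g N n ⟨
      countF (suc g) N (suc n)                                             ∎

    count-antidiagonal : ∀ N n → count N (suc n) ≡ antidiagonal N (λ k m → κ (suc k) m ℤ.* count (suc k) m) n
    count-antidiagonal N n = trans (countF-suc n N n)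
      (antidiagonal-cong N n (λ k m m≤n → cong (λ z → κ (suc k) m ℤ.* z) (countF-fuel n m (suc k) m m≤n ℕₚ.≤-refl)))

    count-zero : ∀ n → count 0 n ≡ one n
    count-zero zero    = refl
    count-zero (suc n) = count-antidiagonal 0 n

    -- A partition with largest part N + 1 loses one copy of it and may still contain others, which
    -- is why `count (suc N)` stands on both sides.
    count-suc : ∀ N n → count (suc N) n ≡ count N n ℤ.+ delay (suc N) (λ m → κ (suc N) m ℤ.* count (suc N) m) n
    count-suc N zero    = refl
    count-suc N (suc n) = begin
      count (suc N) (suc n)                                               ≡⟨ count-antidiagonal (suc N) n ⟩
      antidiagonal (suc N) h n                                            ≡⟨ antidiagonal-suc N h n ⟩
      antidiagonal N h n ℤ.+ delay N (h N) n                              ≡⟨ cong (ℤ._+ delay N (h N) n) (count-antidiagonal N n) ⟨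
      count N (suc n) ℤ.+ delay N (h N) n                                 ∎
      where
      h : ℕ → Series
      h k m = κ (suc k) m ℤ.* count (suc k) m

    count-total : ∀ N n → n ≤ N → count N n ≡ total (λ l → if nonIncreasing l then weight l else + 0) (compositions n)
    count-total N n n≤N = total-cong (All.map (λ {l} eq → cong (λ b → if b then weight l else + 0) (nonIncreasing-∷ N l (subst (_≤ N) (sym eq) n≤N))) (compositionsF-sum n n))

  module Plain = Weighted (λ _ _ → + 1)
  module Signed = Weighted (λ N m → sign (⌊ N /2⌋ ℕ.+ m))

  plain-weight : ∀ l → Plain.weight l ≡ + 1
  plain-weight []      = refl
  plain-weight (N ∷ l) = trans (ℤₚ.*-identityˡ _) (plain-weight l)

  signed-weight : ∀ l → Signed.weight l ≡ sign (exponent l)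
  signed-weight []      = refl
  signed-weight (N ∷ l) = trans (cong (λ z → sign (⌊ N /2⌋ ℕ.+ sum l) ℤ.* z) (signed-weight l)) (sym (sign-+ (⌊ N /2⌋ ℕ.+ sum l) (exponent l)))

  p-count : ∀ N n → n ≤ N → + p n ≡ Plain.count N n
  p-count N n n≤N = trans (main (compositions n)) (sym (Plain.count-total N n n≤N))
    where
    main : ∀ ls → + length (filter (λ l → nonIncreasing l Bool.≟ true) ls) ≡ total (λ l → if nonIncreasing l then Plain.weight l else + 0) ls
    main []       = refl
    main (l ∷ ls) with nonIncreasing l
    ... | true  = cong₂ ℤ._+_ (sym (plain-weight l)) (main ls)
    ... | false = trans (main ls) (sym (ℤₚ.+-identityˡ _))

  -- The partitions counted by `t` contribute 1 and the other p - t contribute -1; for N ≥ n the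
  -- bound on the parts excludes nothing.
  t-count : ∀ N n → n ≤ N → (+ t n ℤ.+ + t n) ℤ.- + p n ≡ Signed.count N n
  t-count N n n≤N = trans (main (compositions n)) (sym (Signed.count-total N n n≤N))
    where
    P : List (List ℕ) → List (List ℕ)
    P = filter (λ l → nonIncreasing l Bool.≟ true)
    T : List (List ℕ) → List (List ℕ)
    T = filter (λ l → sameMod4 l Bool.≟ true)
    identity⁺ : ∀ t p → ((+ 1 ℤ.+ t) ℤ.+ (+ 1 ℤ.+ t)) ℤ.- (+ 1 ℤ.+ p) ≡ + 1 ℤ.+ ((t ℤ.+ t) ℤ.- p)
    identity⁺ = ℤ-Solver.solve-∀
    identity⁻ : ∀ t p → (t ℤ.+ t) ℤ.- (+ 1 ℤ.+ p) ≡ ℤ.- + 1 ℤ.+ ((t ℤ.+ t) ℤ.- p)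
    identity⁻ = ℤ-Solver.solve-∀
    main : ∀ ls → (+ length (T (P ls)) ℤ.+ + length (T (P ls))) ℤ.- + length (P ls) ≡ total (λ l → if nonIncreasing l then Signed.weight l else + 0) ls
    main []       = refl
    main (l ∷ ls) with nonIncreasing l in eq
    ... | false = trans (main ls) (sym (ℤₚ.+-identityˡ _))
    ... | true with sameMod4 l | trans (signed-weight l) (sign-sameMod4 l eq)
    ...   | true  | w = trans (identity⁺ (+ length (T (P ls))) (+ length (P ls))) (cong₂ ℤ._+_ (sym w) (main ls))
    ...   | false | w = trans (identity⁻ (+ length (T (P ls))) (+ length (P ls))) (cong₂ ℤ._+_ (sym w) (main ls))

-- Formal power series and their truncations

module PowerSeries where

  open ≡-Reasoning
  open PartitionSigns using (sign; sign-+)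
  open PartitionCounts

  -- The Cauchy product by recursion on the degree, stripping the first coefficient of f; in this
  -- form the ring laws are inductions.
  conv : Series → Series → Series
  conv f g zero    = f 0 ℤ.* g 0
  conv f g (suc n) = f 0 ℤ.* g (suc n) ℤ.+ conv (f ∘ suc) g n

  ⊛-conv : ∀ f g n → (f ⊛ g) n ≡ conv f g n
  ⊛-conv f g n = trans (cong (foldr ℤ._+_ (+ 0)) (map-upTo (λ k → f k ℤ.* g (n ∸ k)) (suc n))) (main f n)
    where
    main : ∀ f n → foldr ℤ._+_ (+ 0) (applyUpTo (λ k → f k ℤ.* g (n ∸ k)) (suc n)) ≡ conv f g n
    main f zero    = ℤₚ.+-identityʳ _
    main f (suc n) = cong (λ z → f 0 ℤ.* g (suc n) ℤ.+ z) (main (f ∘ suc) n)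

  conv-cong : ∀ {f f′ g g′} n → (∀ k → k ≤ n → f k ≡ f′ k) → (∀ k → k ≤ n → g k ≡ g′ k) → conv f g n ≡ conv f′ g′ n
  conv-cong zero    hf hg = cong₂ ℤ._*_ (hf 0 z≤n) (hg 0 z≤n)
  conv-cong (suc n) hf hg = cong₂ ℤ._+_ (cong₂ ℤ._*_ (hf 0 z≤n) (hg (suc n) ℕₚ.≤-refl))
    (conv-cong n (λ k k≤n → hf (suc k) (s≤s k≤n)) (λ k k≤n → hg k (ℕₚ.m≤n⇒m≤1+n k≤n)))

  conv-sucʳ : ∀ f g n → conv f g (suc n) ≡ conv f (g ∘ suc) n ℤ.+ f (suc n) ℤ.* g 0
  conv-sucʳ f g zero    = refl
  conv-sucʳ f g (suc n) = trans (cong (λ z → f 0 ℤ.* g (suc (suc n)) ℤ.+ z) (conv-sucʳ (f ∘ suc) g n)) (sym (ℤₚ.+-assoc (f 0 ℤ.* g (suc (suc n))) _ _))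

  conv-comm : ∀ f g n → conv f g n ≡ conv g f n
  conv-comm f g zero    = ℤₚ.*-comm (f 0) (g 0)
  conv-comm f g (suc n) = begin
    f 0 ℤ.* g (suc n) ℤ.+ conv (f ∘ suc) g n      ≡⟨ cong₂ ℤ._+_ (ℤₚ.*-comm (f 0) (g (suc n))) (conv-comm (f ∘ suc) g n) ⟩
    g (suc n) ℤ.* f 0 ℤ.+ conv g (f ∘ suc) n      ≡⟨ ℤₚ.+-comm (g (suc n) ℤ.* f 0) _ ⟩
    conv g (f ∘ suc) n ℤ.+ g (suc n) ℤ.* f 0      ≡⟨ conv-sucʳ g f n ⟨
    conv g f (suc n)                              ∎

  conv-+ : ∀ f g h n → conv (λ k → f k ℤ.+ g k) h n ≡ conv f h n ℤ.+ conv g h n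
  conv-+ f g h zero    = ℤₚ.*-distribʳ-+ (h 0) (f 0) (g 0)
  conv-+ f g h (suc n) = trans (cong (λ z → (f 0 ℤ.+ g 0) ℤ.* h (suc n) ℤ.+ z) (conv-+ (f ∘ suc) (g ∘ suc) h n))
    (identity (f 0) (g 0) (h (suc n)) (conv (f ∘ suc) h n) (conv (g ∘ suc) h n))
    where
    identity : ∀ a b c d e → (a ℤ.+ b) ℤ.* c ℤ.+ (d ℤ.+ e) ≡ (a ℤ.* c ℤ.+ d) ℤ.+ (b ℤ.* c ℤ.+ e)
    identity = ℤ-Solver.solve-∀

  conv-scale : ∀ c f g n → conv (λ k → c ℤ.* f k) g n ≡ c ℤ.* conv f g n
  conv-scale c f g zero    = ℤₚ.*-assoc c (f 0) (g 0)
  conv-scale c f g (suc n) = trans (cong (λ z → c ℤ.* f 0 ℤ.* g (suc n) ℤ.+ z) (conv-scale c (f ∘ suc) g n)) (identity c (f 0) (g (suc n)) (conv (f ∘ suc) g n))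
    where
    identity : ∀ a b c d → a ℤ.* b ℤ.* c ℤ.+ a ℤ.* d ≡ a ℤ.* (b ℤ.* c ℤ.+ d)
    identity = ℤ-Solver.solve-∀

  conv-assoc : ∀ f g h n → conv (conv f g) h n ≡ conv f (conv g h) n
  conv-assoc f g h zero    = ℤₚ.*-assoc (f 0) (g 0) (h 0)
  conv-assoc f g h (suc n) = begin
    f 0 ℤ.* g 0 ℤ.* h (suc n) ℤ.+ conv (λ k → f 0 ℤ.* g (suc k) ℤ.+ conv (f ∘ suc) g k) h n
      ≡⟨ cong (λ z → f 0 ℤ.* g 0 ℤ.* h (suc n) ℤ.+ z) (conv-+ (λ k → f 0 ℤ.* g (suc k)) (conv (f ∘ suc) g) h n) ⟩
    f 0 ℤ.* g 0 ℤ.* h (suc n) ℤ.+ (conv (λ k → f 0 ℤ.* g (suc k)) h n ℤ.+ conv (conv (f ∘ suc) g) h n)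
      ≡⟨ cong₂ (λ x y → f 0 ℤ.* g 0 ℤ.* h (suc n) ℤ.+ (x ℤ.+ y)) (conv-scale (f 0) (g ∘ suc) h n) (conv-assoc (f ∘ suc) g h n) ⟩
    f 0 ℤ.* g 0 ℤ.* h (suc n) ℤ.+ (f 0 ℤ.* conv (g ∘ suc) h n ℤ.+ conv (f ∘ suc) (conv g h) n)
      ≡⟨ identity (f 0) (g 0) (h (suc n)) (conv (g ∘ suc) h n) (conv (f ∘ suc) (conv g h) n) ⟩
    f 0 ℤ.* (g 0 ℤ.* h (suc n) ℤ.+ conv (g ∘ suc) h n) ℤ.+ conv (f ∘ suc) (conv g h) n  ∎
    where
    identity : ∀ a b c d e → a ℤ.* b ℤ.* c ℤ.+ (a ℤ.* d ℤ.+ e) ≡ a ℤ.* (b ℤ.* c ℤ.+ d) ℤ.+ e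
    identity = ℤ-Solver.solve-∀

  conv-zeroˡ : ∀ g n → conv (λ _ → + 0) g n ≡ + 0
  conv-zeroˡ g zero    = refl
  conv-zeroˡ g (suc n) = trans (ℤₚ.+-identityˡ _) (conv-zeroˡ g n)

  conv-identityˡ : ∀ g n → conv one g n ≡ g n
  conv-identityˡ g zero    = ℤₚ.*-identityˡ (g 0)
  conv-identityˡ g (suc n) = trans (cong₂ ℤ._+_ (ℤₚ.*-identityˡ (g (suc n))) (conv-zeroˡ g n)) (ℤₚ.+-identityʳ _)

  -- The ring ℤ⟦q⟧/(qᴹ), in which infinite products are finite and q is nilpotent.
  module Truncated (M : ℕ) where

    infix 4 _≋_
    -- A record, so that both series can be inferred from a proof.
    record _≋_ (f g : Series) : Set where
      constructor coefficientwise
      field coefficient : ∀ n → n < M → f n ≡ g n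

    open _≋_ public

    ⊛-cong : ∀ {f f′ g g′} → f ≋ f′ → g ≋ g′ → f ⊛ g ≋ f′ ⊛ g′
    ⊛-cong {f} {f′} {g} {g′} hf hg .coefficient n n<M = trans (⊛-conv f g n) (trans
      (conv-cong n (λ k k≤n → coefficient hf k (ℕₚ.≤-<-trans k≤n n<M)) (λ k k≤n → coefficient hg k (ℕₚ.≤-<-trans k≤n n<M)))
      (sym (⊛-conv f′ g′ n)))

    ⊛-comm : ∀ f g → f ⊛ g ≋ g ⊛ f
    ⊛-comm f g .coefficient n _ = trans (⊛-conv f g n) (trans (conv-comm f g n) (sym (⊛-conv g f n)))

    ⊛-assoc : ∀ f g h → (f ⊛ g) ⊛ h ≋ f ⊛ (g ⊛ h)
    ⊛-assoc f g h .coefficient n _ = begin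
      ((f ⊛ g) ⊛ h) n          ≡⟨ ⊛-conv (f ⊛ g) h n ⟩
      conv (f ⊛ g) h n         ≡⟨ conv-cong n (λ k _ → ⊛-conv f g k) (λ _ _ → refl) ⟩
      conv (conv f g) h n      ≡⟨ conv-assoc f g h n ⟩
      conv f (conv g h) n      ≡⟨ conv-cong n (λ _ _ → refl) (λ k _ → ⊛-conv g h k) ⟨
      conv f (g ⊛ h) n         ≡⟨ ⊛-conv f (g ⊛ h) n ⟨
      (f ⊛ (g ⊛ h)) n          ∎

    ⊛-identityˡ : ∀ f → one ⊛ f ≋ f
    ⊛-identityˡ f .coefficient n _ = trans (⊛-conv one f n) (conv-identityˡ f n)

    infixl 6 _⊕_
    _⊕_ : Series → Series → Series
    (f ⊕ g) n = f n ℤ.+ g n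

    ⊕-cong : ∀ {f f′ g g′} → f ≋ f′ → g ≋ g′ → f ⊕ g ≋ f′ ⊕ g′
    ⊕-cong hf hg .coefficient n n<M = cong₂ ℤ._+_ (coefficient hf n n<M) (coefficient hg n n<M)

    ⊛-distribʳ : ∀ h f g → (f ⊕ g) ⊛ h ≋ f ⊛ h ⊕ g ⊛ h
    ⊛-distribʳ h f g .coefficient n _ = trans (⊛-conv (f ⊕ g) h n) (trans (conv-+ f g h n) (cong₂ ℤ._+_ (sym (⊛-conv f h n)) (sym (⊛-conv g h n))))

    ≋-trans : ∀ {f g h} → f ≋ g → g ≋ h → f ≋ h
    ≋-trans fg gh .coefficient n n<M = trans (coefficient fg n n<M) (coefficient gh n n<M)

    ring : CommutativeRing _ _
    ring = record
      { Carrier = Series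
      ; _≈_ = _≋_
      ; _+_ = _⊕_
      ; _*_ = _⊛_
      ; -_ = λ f n → ℤ.- f n
      ; 0# = λ _ → + 0
      ; 1# = one
      ; isCommutativeRing = record
        { isRing = record
          { +-isAbelianGroup = record
            { isGroup = record
              { isMonoid = record
                { isSemigroup = record
                  { isMagma = record
                    { isEquivalence = record
                      { refl = coefficientwise λ _ _ → refl
                      ; sym = λ h → coefficientwise λ n n<M → sym (coefficient h n n<M)
                      ; trans = ≋-trans
                      }
                    ; ∙-cong = ⊕-cong
                    }
                  ; assoc = λ f g h → coefficientwise λ n _ → ℤₚ.+-assoc (f n) (g n) (h n)
                  }
                ; identity = (λ f → coefficientwise λ n _ → ℤₚ.+-identityˡ (f n)) , (λ f → coefficientwise λ n _ → ℤₚ.+-identityʳ (f n))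
                }
              ; inverse = (λ f → coefficientwise λ n _ → ℤₚ.+-inverseˡ (f n)) , (λ f → coefficientwise λ n _ → ℤₚ.+-inverseʳ (f n))
              ; ⁻¹-cong = λ h → coefficientwise λ n n<M → cong ℤ.-_ (coefficient h n n<M)
              }
            ; comm = λ f g → coefficientwise λ n _ → ℤₚ.+-comm (f n) (g n)
            }
          ; *-cong = ⊛-cong
          ; *-assoc = ⊛-assoc
          ; *-identity = ⊛-identityˡ , (λ f → ≋-trans (⊛-comm f one) (⊛-identityˡ f))
          ; distrib = (λ h f g → ≋-trans (⊛-comm h (f ⊕ g)) (≋-trans (⊛-distribʳ h f g) (⊕-cong (⊛-comm f h) (⊛-comm g h))))
                    , ⊛-distribʳ
          }
        ; *-comm = ⊛-comm
        }
      }

  delay-< : ∀ k f n → n < k → delay k f n ≡ + 0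
  delay-< (suc k) f zero    _         = refl
  delay-< (suc k) f (suc n) (s≤s n<k) = delay-< k f n n<k

  delay-+ : ∀ k f r → delay k f (k ℕ.+ r) ≡ f r
  delay-+ zero    f r = refl
  delay-+ (suc k) f r = delay-+ k f r

  delay-cong : ∀ k {f g} → (∀ n → f n ≡ g n) → ∀ n → delay k f n ≡ delay k g n
  delay-cong zero    h n       = h n
  delay-cong (suc k) h zero    = refl
  delay-cong (suc k) h (suc n) = delay-cong k h n

  delay-scale : ∀ k c f n → delay k (λ m → c ℤ.* f m) n ≡ c ℤ.* delay k f n
  delay-scale zero    c f n       = refl
  delay-scale (suc k) c f zero    = sym (ℤₚ.*-zeroʳ c)
  delay-scale (suc k) c f (suc n) = delay-scale k c f n

  -- Multiplying coefficients by `sign` is the substitution q ↦ -q, which sends qᵏ f(q) to (-q)ᵏ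
  -- f(-q).
  delay-sign : ∀ k f n → sign n ℤ.* delay k f n ≡ delay k (λ m → sign (k ℕ.+ m) ℤ.* f m) n
  delay-sign zero    f n       = refl
  delay-sign (suc k) f zero    = refl
  delay-sign (suc k) f (suc n) = begin
    ℤ.- sign n ℤ.* delay k f n                              ≡⟨ identity (sign n) (delay k f n) ⟩
    ℤ.- + 1 ℤ.* (sign n ℤ.* delay k f n)                    ≡⟨ cong (λ z → ℤ.- + 1 ℤ.* z) (delay-sign k f n) ⟩
    ℤ.- + 1 ℤ.* delay k (λ m → sign (k ℕ.+ m) ℤ.* f m) n    ≡⟨ delay-scale k (ℤ.- + 1) (λ m → sign (k ℕ.+ m) ℤ.* f m) n ⟨
    delay k (λ m → ℤ.- + 1 ℤ.* (sign (k ℕ.+ m) ℤ.* f m)) n  ≡⟨ delay-cong k (λ m → sym (identity (sign (k ℕ.+ m)) (f m))) n ⟩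
    delay k (λ m → ℤ.- sign (k ℕ.+ m) ℤ.* f m) n            ∎
    where
    identity : ∀ a b → ℤ.- a ℤ.* b ≡ ℤ.- + 1 ℤ.* (a ℤ.* b)
    identity = ℤ-Solver.solve-∀

  sign-square : ∀ n → sign n ℤ.* sign n ≡ + 1
  sign-square zero    = refl
  sign-square (suc n) = trans (identity (sign n)) (sign-square n)
    where
    identity : ∀ a → ℤ.- a ℤ.* ℤ.- a ≡ a ℤ.* a
    identity = ℤ-Solver.solve-∀

  sign-even : ∀ n → sign (n ℕ.* 2) ≡ + 1
  sign-even zero    = refl
  sign-even (suc n) = trans (ℤₚ.neg-involutive _) (sign-even n)

  half-even : ∀ n → ⌊ n ℕ.* 2 /2⌋ ≡ n
  half-even zero    = refl
  half-even (suc n) = cong suc (half-even n)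

  half-odd : ∀ n → ⌊ suc (n ℕ.* 2) /2⌋ ≡ n
  half-odd zero    = refl
  half-odd (suc n) = cong suc (half-odd n)

  monomial-coefficient : ∀ m n → delay m one n ≡ (if ⌊ n ≟ m ⌋ then + 1 else + 0)
  monomial-coefficient zero    zero    = refl
  monomial-coefficient zero    (suc n) = refl
  monomial-coefficient (suc m) zero    = refl
  monomial-coefficient (suc m) (suc n) = trans (monomial-coefficient m n) (cong (λ b → if b then + 1 else + 0) ≟-suc)
    where
    ≟-suc : ⌊ n ≟ m ⌋ ≡ ⌊ suc n ≟ suc m ⌋
    ≟-suc with n ≟ m | suc n ≟ suc m
    ... | yes _   | yes _   = refl
    ... | no _    | no _    = refl
    ... | yes n≡m | no h    = contradiction (cong suc n≡m) h
    ... | no h    | yes n≡m = contradiction (ℕₚ.suc-injective n≡m) h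

  geom-∣ : ∀ {m n} → m ∣ n → geom m n ≡ + 1
  geom-∣ {m} {n} m∣n with m ∣? n
  ... | yes _  = refl
  ... | no m∤n = contradiction m∣n m∤n

  geom-∤ : ∀ {m n} → ¬ m ∣ n → geom m n ≡ + 0
  geom-∤ {m} {n} m∤n with m ∣? n
  ... | yes m∣n = contradiction m∣n m∤n
  ... | no _    = refl

  geom-+ : ∀ m n → geom m (m ℕ.+ n) ≡ geom m n
  geom-+ m n with m ∣? n
  ... | yes m∣n = geom-∣ (∣m∣n⇒∣m+n ∣-refl m∣n)
  ... | no m∤n  = geom-∤ (λ m∣m+n → m∤n (∣m+n∣m⇒∣n m∣m+n ∣-refl))

  geom-< : ∀ m n → n < m → geom m n ≡ one n
  geom-< m zero    n<m = geom-∣ (m ∣0)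
  geom-< m (suc n) n<m = geom-∤ (λ m∣n → ℕₚ.<⇒≱ n<m (∣⇒≤ m∣n))

  geom-delay : ∀ m n → 0 < m → geom m n ℤ.- delay m (geom m) n ≡ one n
  geom-delay m n 0<m with n ℕ.<? m
  ... | yes n<m = trans (cong₂ ℤ._-_ (geom-< m n n<m) (delay-< m (geom m) n n<m)) (ℤₚ.+-identityʳ (one n))
  ... | no n≮m = begin
    geom m n ℤ.- delay m (geom m) n                                    ≡⟨ cong (λ k → geom m k ℤ.- delay m (geom m) k) (sym n≡) ⟩
    geom m (m ℕ.+ (n ∸ m)) ℤ.- delay m (geom m) (m ℕ.+ (n ∸ m))        ≡⟨ cong₂ ℤ._-_ (geom-+ m (n ∸ m)) (delay-+ m (geom m) (n ∸ m)) ⟩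
    geom m (n ∸ m) ℤ.- geom m (n ∸ m)                                  ≡⟨ ℤₚ.+-inverseʳ (geom m (n ∸ m)) ⟩
    + 0                                                                ≡⟨ one-positive n (ℕₚ.<-≤-trans 0<m (ℕₚ.≮⇒≥ n≮m)) ⟨
    one n                                                              ∎
    where
    n≡ : m ℕ.+ (n ∸ m) ≡ n
    n≡ = ℕₚ.m+[n∸m]≡n (ℕₚ.≮⇒≥ n≮m)
    one-positive : ∀ n → 0 < n → one n ≡ + 0
    one-positive (suc n) _ = refl

  oneMinusX^-< : ∀ m n → n < m → oneMinusX^ m n ≡ one n
  oneMinusX^-< m n n<m = trans (cong (λ z → one n ℤ.- z) (trans (sym (monomial-coefficient m n)) (delay-< m one n n<m))) (ℤₚ.+-identityʳ (one n))

  -- Factors of index above n agree with 1 through degree n. Hence the diagonal definition of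
  -- `infProd` coincides, below degree M, with a single product of M factors.
  prodUpTo-stable : ∀ s → (∀ k j → j ≤ k → s (suc k) j ≡ one j) → ∀ d n → prodUpTo s (d ℕ.+ n) n ≡ prodUpTo s n n
  prodUpTo-stable s h zero    n = refl
  prodUpTo-stable s h (suc d) n = begin
    (prodUpTo s (d ℕ.+ n) ⊛ s (suc (d ℕ.+ n))) n        ≡⟨ ⊛-conv (prodUpTo s (d ℕ.+ n)) (s (suc (d ℕ.+ n))) n ⟩
    conv (prodUpTo s (d ℕ.+ n)) (s (suc (d ℕ.+ n))) n   ≡⟨ conv-cong n (λ _ _ → refl) (λ k k≤n → h (d ℕ.+ n) k (ℕₚ.≤-trans k≤n (ℕₚ.m≤n+m n d))) ⟩
    conv (prodUpTo s (d ℕ.+ n)) one n                   ≡⟨ conv-comm (prodUpTo s (d ℕ.+ n)) one n ⟩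
    conv one (prodUpTo s (d ℕ.+ n)) n                   ≡⟨ conv-identityˡ (prodUpTo s (d ℕ.+ n)) n ⟩
    prodUpTo s (d ℕ.+ n) n                              ≡⟨ prodUpTo-stable s h d n ⟩
    prodUpTo s n n                                      ∎

  -- conjugateCount is signedCount with q replaced by -q.
  signedCount conjugateCount : ℕ → Series
  signedCount = Signed.count
  conjugateCount N n = sign n ℤ.* Signed.count N n

  signedCount-suc : ∀ N n → signedCount (suc N) n ≡ signedCount N n ℤ.+ sign ⌊ suc N /2⌋ ℤ.* delay (suc N) (conjugateCount (suc N)) n
  signedCount-suc N n = trans (Signed.count-suc N n) (cong (λ z → signedCount N n ℤ.+ z) (trans
    (delay-cong (suc N) (λ m → trans (cong (ℤ._* signedCount (suc N) m) (sign-+ ⌊ suc N /2⌋ m)) (ℤₚ.*-assoc (sign ⌊ suc N /2⌋) (sign m) _)) n)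
    (delay-scale (suc N) (sign ⌊ suc N /2⌋) (conjugateCount (suc N)) n)))

  conjugateCount-suc : ∀ N n → conjugateCount (suc N) n ≡ conjugateCount N n ℤ.+ sign (suc N) ℤ.* sign ⌊ suc N /2⌋ ℤ.* delay (suc N) (signedCount (suc N)) n
  conjugateCount-suc N n = begin
    sign n ℤ.* signedCount (suc N) n                                              ≡⟨ cong (λ z → sign n ℤ.* z) (Signed.count-suc N n) ⟩
    sign n ℤ.* (signedCount N n ℤ.+ delay (suc N) w n)                            ≡⟨ ℤₚ.*-distribˡ-+ (sign n) (signedCount N n) (delay (suc N) w n) ⟩
    conjugateCount N n ℤ.+ sign n ℤ.* delay (suc N) w n                           ≡⟨ cong (λ z → conjugateCount N n ℤ.+ z) (trans (delay-sign (suc N) w n) (trans (delay-cong (suc N) signs n) (delay-scale (suc N) c (signedCount (suc N)) n))) ⟩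
    conjugateCount N n ℤ.+ c ℤ.* delay (suc N) (signedCount (suc N)) n            ∎
    where
    c = sign (suc N) ℤ.* sign ⌊ suc N /2⌋
    w : Series
    w m = sign (⌊ suc N /2⌋ ℕ.+ m) ℤ.* signedCount (suc N) m
    identity : ∀ a b c d → a ℤ.* c ℤ.* (b ℤ.* c ℤ.* d) ≡ a ℤ.* b ℤ.* (c ℤ.* c) ℤ.* d
    identity = ℤ-Solver.solve-∀
    signs : ∀ m → sign (suc N ℕ.+ m) ℤ.* w m ≡ c ℤ.* signedCount (suc N) m
    signs m = begin
      sign (suc N ℕ.+ m) ℤ.* (sign (⌊ suc N /2⌋ ℕ.+ m) ℤ.* x)                ≡⟨ cong₂ (λ a b → a ℤ.* (b ℤ.* x)) (sign-+ (suc N) m) (sign-+ ⌊ suc N /2⌋ m) ⟩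
      sign (suc N) ℤ.* sign m ℤ.* (sign ⌊ suc N /2⌋ ℤ.* sign m ℤ.* x)        ≡⟨ identity (sign (suc N)) (sign ⌊ suc N /2⌋) (sign m) x ⟩
      -- One `sign m` stems from the weight and the other from q ↦ -q; they cancel, and the
      -- companion's recurrence refers back to `signedCount`.
      c ℤ.* (sign m ℤ.* sign m) ℤ.* x                                        ≡⟨ cong (λ z → c ℤ.* z ℤ.* x) (sign-square m) ⟩
      c ℤ.* + 1 ℤ.* x                                                        ≡⟨ cong (ℤ._* x) (ℤₚ.*-identityʳ c) ⟩
      c ℤ.* x                                                                ∎
      where x = signedCount (suc N) m

open PartitionSigns using (sign)
open PartitionCounts
open PowerSeries

-- Application to the generating functions modulo qᴹ

module Coefficients (M : ℕ) where

  open Truncated M using (_≋_; coefficientwise; coefficient; ring; ≋-trans; ⊛-identityˡ)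
  open Products ring hiding (ring; sym; trans; refl)
  private module R = CommutativeRing ring
  open Stanley ring using (module Recurrence)
  open import Relation.Binary.Reasoning.Setoid R.setoid

  X : Series
  X = delay 1 one

  X-⊛ : ∀ f n → (X ⊛ f) n ≡ delay 1 f n
  X-⊛ f zero    = trans (⊛-conv X f 0) refl
  X-⊛ f (suc n) = trans (⊛-conv X f (suc n)) (trans (ℤₚ.+-identityˡ _) (conv-identityˡ f n))

  X^-⊛ : ∀ k f → X ^ k ⊛ f ≋ delay k f
  X^-⊛ zero    f = ⊛-identityˡ f
  X^-⊛ (suc k) f = begin
    X ⊛ X ^ k ⊛ f         ≈⟨ *-assoc X (X ^ k) f ⟩
    X ⊛ (X ^ k ⊛ f)       ≈⟨ *-congˡ {X} (X^-⊛ k f) ⟩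
    X ⊛ delay k f         ≈⟨ coefficientwise (λ n _ → trans (X-⊛ (delay k f) n) (delay-suc n)) ⟩
    delay (suc k) f       ∎
    where
    delay-suc : ∀ n → delay 1 (delay k f) n ≡ delay (suc k) f n
    delay-suc zero    = refl
    delay-suc (suc n) = refl

  X^-monomial : ∀ k → X ^ k ≋ delay k one
  X^-monomial k = ≋-trans (R.sym (*-identityʳ (X ^ k))) (X^-⊛ k one)

  X^M≋0 : X ^ M ≋ 0#
  X^M≋0 = ≋-trans (X^-monomial M) (coefficientwise (λ n → delay-< M one n))

  oneMinusX^-≋ : ∀ m → oneMinusX^ m ≋ 1# - X ^ m
  oneMinusX^-≋ m = ≋-trans (coefficientwise (λ n _ → cong (λ z → one n ℤ.- z) (sym (monomial-coefficient m n))))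
                           (+-congˡ {1#} (-‿cong (R.sym (X^-monomial m))))

  geom-inverse : ∀ m → 0 < m → oneMinusX^ m ⊛ geom m ≋ one
  geom-inverse m 0<m = begin
    oneMinusX^ m ⊛ geom m                  ≈⟨ *-congʳ {geom m} (oneMinusX^-≋ m) ⟩
    (1# - X ^ m) ⊛ geom m                  ≈⟨ [1-x]*g≈g-x*g (X ^ m) (geom m) ⟩
    geom m - X ^ m ⊛ geom m                ≈⟨ +-congˡ {geom m} (-‿cong (X^-⊛ m (geom m))) ⟩
    geom m - delay m (geom m)              ≈⟨ coefficientwise (λ n _ → geom-delay m n 0<m) ⟩
    one                                    ∎

  prodUpTo-∏ : ∀ s K → prodUpTo s K ≋ ∏ (λ i → s (suc i)) K
  prodUpTo-∏ s zero    = R.refl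
  prodUpTo-∏ s (suc K) = *-congʳ {s (suc K)} (prodUpTo-∏ s K)

  infProd-∏ : ∀ s → (∀ k j → j ≤ k → s (suc k) j ≡ one j) → infProd s ≋ ∏ (λ i → s (suc i)) M
  infProd-∏ s h = ≋-trans (coefficientwise λ n n<M → trans (sym (prodUpTo-stable s h (M ∸ n) n)) (cong (λ K → prodUpTo s K n) (ℕₚ.m∸n+n≡m (ℕₚ.<⇒≤ n<M))))
                          (prodUpTo-∏ s M)

  E : ℕ → Series
  E k = poch (X ^ k) (X ^ k) M

  j<[1+a]*[1+k] : ∀ a k j → j ≤ k → j < suc a ℕ.* suc k
  j<[1+a]*[1+k] a k j j≤k = ℕₚ.≤-trans (s≤s j≤k) (ℕₚ.m≤m+n (suc k) (a ℕ.* suc k))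

  E-factor : ∀ a i → oneMinusX^ (a ℕ.* suc i) ≋ 1# - X ^ a ⊛ (X ^ a) ^ i
  E-factor a i = ≋-trans (oneMinusX^-≋ (a ℕ.* suc i)) (+-congˡ {1#} (-‿cong (R.sym (^-assocʳ X a (suc i)))))

  qPoch-E : ∀ a → qPoch (suc a) ≋ E (suc a)
  qPoch-E a = ≋-trans (infProd-∏ (λ k → oneMinusX^ (suc a ℕ.* k)) (λ k j j≤k → oneMinusX^-< (suc a ℕ.* suc k) j (j<[1+a]*[1+k] a k j j≤k)))
                      (∏-cong (E-factor (suc a)) M)

  E-inverse : ∀ a → E (suc a) ⊛ qPochInv (suc a) ≋ one
  E-inverse a = ≋-trans
    (*-congˡ {E (suc a)} (infProd-∏ (λ k → geom (suc a ℕ.* k)) (λ k j j≤k → geom-< (suc a ℕ.* suc k) j (j<[1+a]*[1+k] a k j j≤k))))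
    (∏-inverse {λ i → 1# - X ^ suc a ⊛ (X ^ suc a) ^ i} {λ i → geom (suc a ℕ.* suc i)} factor-inverse M)
    where
    factor-inverse : ∀ i → (1# - X ^ suc a ⊛ (X ^ suc a) ^ i) ⊛ geom (suc a ℕ.* suc i) ≋ one
    factor-inverse i = ≋-trans (*-congʳ {geom (suc a ℕ.* suc i)} (R.sym (E-factor (suc a) i))) (geom-inverse (suc a ℕ.* suc i) (s≤s z≤n))

  plain-product : ∀ N → Plain.count N ⊛ poch X X N ≋ one
  plain-product zero    = ≋-trans (*-identityʳ (Plain.count 0)) (coefficientwise (λ n _ → Plain.count-zero n))
  plain-product (suc N) = begin
    Plain.count (suc N) ⊛ (poch X X N ⊛ (1# - X ^ suc N))                    ≈⟨ c*[e*[1-x]]≈[c-x*c]*e (Plain.count (suc N)) (poch X X N) (X ^ suc N) ⟩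
    (Plain.count (suc N) - X ^ suc N ⊛ Plain.count (suc N)) ⊛ poch X X N     ≈⟨ *-congʳ {poch X X N} peel ⟩
    Plain.count N ⊛ poch X X N                                               ≈⟨ plain-product N ⟩
    one                                                                      ∎
    where
    cancel : ∀ a b → (a ℤ.+ b) ℤ.- b ≡ a
    cancel = ℤ-Solver.solve-∀
    peel : Plain.count (suc N) - X ^ suc N ⊛ Plain.count (suc N) ≋ Plain.count N
    peel = ≋-trans (+-congˡ {Plain.count (suc N)} (-‿cong (X^-⊛ (suc N) (Plain.count (suc N))))) (coefficientwise λ n _ → trans
      (cong (ℤ._- delay (suc N) (Plain.count (suc N)) n)
        (trans (Plain.count-suc N n) (cong (λ z → Plain.count N n ℤ.+ z) (delay-cong (suc N) (λ m → ℤₚ.*-identityˡ _) n))))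
      (cancel (Plain.count N n) (delay (suc N) (Plain.count (suc N)) n)))

  P : Series
  P n = + p n

  P-inverse : P ⊛ E 1 ≋ one
  P-inverse = ≋-trans
    (*-cong {P} {Plain.count M} {E 1} {poch X X M} (coefficientwise (λ n n<M → p-count M n (ℕₚ.<⇒≤ n<M))) (poch-cong (*-identityʳ X) (*-identityʳ X) M))
    (plain-product M)

  signed-power : ∀ j f → (- (X ⊛ X)) ^ j ⊛ f ≋ (λ n → sign j ℤ.* delay (j ℕ.* 2) f n)
  signed-power zero    f = ≋-trans (⊛-identityˡ f) (coefficientwise (λ n _ → sym (ℤₚ.*-identityˡ (f n))))
  signed-power (suc j) f = begin
    - (X ⊛ X) ⊛ (- (X ⊛ X)) ^ j ⊛ f                   ≈⟨ -[x*x]*w*f≈-[x*[x*[w*f]]] X ((- (X ⊛ X)) ^ j) f ⟩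
    - (X ⊛ (X ⊛ ((- (X ⊛ X)) ^ j ⊛ f)))               ≈⟨ -‿cong (*-congˡ {X} (*-congˡ {X} (signed-power j f))) ⟩
    - (X ⊛ (X ⊛ g))                                   ≈⟨ coefficientwise (λ n _ → cong ℤ.-_ (trans (X-⊛ (X ⊛ g) n) (delay-cong 1 (X-⊛ g) n))) ⟩
    (λ n → ℤ.- delay 1 (delay 1 g) n)                 ≈⟨ coefficientwise (λ n _ → shifted n) ⟩
    (λ n → sign (suc j) ℤ.* delay (suc j ℕ.* 2) f n)  ∎
    where
    g : Series
    g n = sign j ℤ.* delay (j ℕ.* 2) f n
    shifted : ∀ n → ℤ.- delay 1 (delay 1 g) n ≡ sign (suc j) ℤ.* delay (suc j ℕ.* 2) f n
    shifted zero          = sym (ℤₚ.*-zeroʳ (sign (suc j)))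
    shifted (suc zero)    = sym (ℤₚ.*-zeroʳ (sign (suc j)))
    shifted (suc (suc n)) = ℤₚ.neg-distribˡ-* (sign j) (delay (j ℕ.* 2) f n)

  signed-odd-power : ∀ j f → X ⊛ (- (X ⊛ X)) ^ j ⊛ f ≋ (λ n → sign j ℤ.* delay (suc (j ℕ.* 2)) f n)
  signed-odd-power j f = begin
    X ⊛ (- (X ⊛ X)) ^ j ⊛ f                       ≈⟨ *-assoc X ((- (X ⊛ X)) ^ j) f ⟩
    X ⊛ ((- (X ⊛ X)) ^ j ⊛ f)                     ≈⟨ *-congˡ {X} (signed-power j f) ⟩
    X ⊛ (λ n → sign j ℤ.* delay (j ℕ.* 2) f n)    ≈⟨ coefficientwise (λ n _ → trans (X-⊛ _ n) (shifted n)) ⟩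
    (λ n → sign j ℤ.* delay (suc (j ℕ.* 2)) f n)  ∎
    where
    shifted : ∀ n → delay 1 (λ n → sign j ℤ.* delay (j ℕ.* 2) f n) n ≡ sign j ℤ.* delay (suc (j ℕ.* 2)) f n
    shifted zero    = sym (ℤₚ.*-zeroʳ (sign j))
    shifted (suc n) = refl

  -- For the part 2j + 1 the sign is (-1)ʲ, so that ± q²ʲ⁺¹ is q(-q²)ʲ. Under q ↦ -q this odd power
  -- changes sign, which accounts for the minus in `F̄-odd`; for even parts nothing changes.
  F-odd : ∀ j → signedCount (suc (j ℕ.* 2)) ≋ signedCount (j ℕ.* 2) + X ⊛ (- (X ⊛ X)) ^ j ⊛ conjugateCount (suc (j ℕ.* 2))
  F-odd j = ≋-trans
    (coefficientwise λ n _ → trans (signedCount-suc (j ℕ.* 2) n) (cong (λ h → signedCount (j ℕ.* 2) n ℤ.+ sign h ℤ.* delay (suc (j ℕ.* 2)) (conjugateCount (suc (j ℕ.* 2))) n) (half-odd j)))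
    (+-congˡ {signedCount (j ℕ.* 2)} (R.sym (signed-odd-power j (conjugateCount (suc (j ℕ.* 2))))))

  F-even : ∀ j → signedCount (suc j ℕ.* 2) ≋ signedCount (suc (j ℕ.* 2)) + (- (X ⊛ X)) ^ suc j ⊛ conjugateCount (suc j ℕ.* 2)
  F-even j = ≋-trans
    (coefficientwise λ n _ → trans (signedCount-suc (suc (j ℕ.* 2)) n) (cong (λ h → signedCount (suc (j ℕ.* 2)) n ℤ.+ sign h ℤ.* delay (suc j ℕ.* 2) (conjugateCount (suc j ℕ.* 2)) n) (half-even (suc j))))
    (+-congˡ {signedCount (suc (j ℕ.* 2))} (R.sym (signed-power (suc j) (conjugateCount (suc j ℕ.* 2)))))

  F̄-odd : ∀ j → conjugateCount (suc (j ℕ.* 2)) ≋ conjugateCount (j ℕ.* 2) - X ⊛ (- (X ⊛ X)) ^ j ⊛ signedCount (suc (j ℕ.* 2))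
  F̄-odd j = ≋-trans
    (coefficientwise λ n _ → trans (conjugateCount-suc (j ℕ.* 2) n) (cong (λ z → conjugateCount (j ℕ.* 2) n ℤ.+ z)
      (trans (cong₂ (λ s h → ℤ.- s ℤ.* sign h ℤ.* delay (suc (j ℕ.* 2)) (signedCount (suc (j ℕ.* 2))) n) (sign-even j) (half-odd j))
             (identity (sign j) (delay (suc (j ℕ.* 2)) (signedCount (suc (j ℕ.* 2))) n)))))
    (+-congˡ {conjugateCount (j ℕ.* 2)} (-‿cong (R.sym (signed-odd-power j (signedCount (suc (j ℕ.* 2)))))))
    where
    identity : ∀ s d → ℤ.- + 1 ℤ.* s ℤ.* d ≡ ℤ.- (s ℤ.* d)
    identity = ℤ-Solver.solve-∀

  F̄-even : ∀ j → conjugateCount (suc j ℕ.* 2) ≋ conjugateCount (suc (j ℕ.* 2)) + (- (X ⊛ X)) ^ suc j ⊛ signedCount (suc j ℕ.* 2)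
  F̄-even j = ≋-trans
    (coefficientwise λ n _ → trans (conjugateCount-suc (suc (j ℕ.* 2)) n) (cong (λ z → conjugateCount (suc (j ℕ.* 2)) n ℤ.+ z)
      (trans (cong₂ (λ s h → s ℤ.* sign h ℤ.* delay (suc j ℕ.* 2) (signedCount (suc j ℕ.* 2)) n) (sign-even (suc j)) (half-even (suc j)))
             (cong (ℤ._* delay (suc j ℕ.* 2) (signedCount (suc j ℕ.* 2)) n) (ℤₚ.*-identityˡ (sign (suc j)))))))
    (+-congˡ {conjugateCount (suc (j ℕ.* 2))} (R.sym (signed-power (suc j) (signedCount (suc j ℕ.* 2)))))

  F̄-zero : conjugateCount 0 ≋ one
  F̄-zero .coefficient zero    _ = refl
  F̄-zero .coefficient (suc n) _ = trans (cong (λ z → sign (suc n) ℤ.* z) (Signed.count-zero (suc n))) (ℤₚ.*-zeroʳ (sign (suc n)))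

  quotient : Series
  quotient = qPoch 2 ^ 2 ⊛ qPoch 8 ^ 2 ⊛ qPoch 32 ^ 2 ⊛ qPochInv 1 ⊛ qPochInv 4 ^ 5 ⊛ qPochInv 16

  module Rec = Recurrence X M X^M≋0 signedCount conjugateCount (coefficientwise (λ n _ → Signed.count-zero n)) F̄-zero F-odd F̄-odd F-even F̄-even

  -- The bound 2(M + 1) on the parts has the form 2N with N > M demanded by the product formula, and
  -- it exceeds every degree below M, so all partitions concerned are counted.
  P-F : let r = X ^ 2 ⊛ quotient in P - signedCount (suc M ℕ.* 2) ≋ (r + r) + (r + r)
  P-F = Rec.difference-quotient P (suc M) (ℕₚ.n<1+n M) P-inverse
    {qPoch 2} {qPoch 8} {qPoch 32} {qPochInv 1} {qPochInv 4} {qPochInv 16} (qPoch-E 1) (qPoch-E 7) (qPoch-E 31) (E-inverse 0) (E-inverse 3) (E-inverse 15)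

  P-F-coefficient : ∀ n → n < M → let r = delay 2 quotient n in + p n ℤ.- ((+ t n ℤ.+ + t n) ℤ.- + p n) ≡ (r ℤ.+ r) ℤ.+ (r ℤ.+ r)
  P-F-coefficient n n<M = trans
    (cong (λ z → + p n ℤ.- z) (t-count (suc M ℕ.* 2) n (ℕₚ.≤-trans (ℕₚ.<⇒≤ n<M) (ℕₚ.≤-trans (ℕₚ.n≤1+n M) (ℕₚ.m≤m*n (suc M) 2)))))
    (trans (coefficient P-F n n<M) (cong (λ r → (r ℤ.+ r) ℤ.+ (r ℤ.+ r)) (coefficient (X^-⊛ 2 quotient) n n<M)))

shift-delay : ∀ f n → shift 2 f n ≡ delay 2 f n
shift-delay f zero          = refl
shift-delay f (suc zero)    = refl
shift-delay f (suc (suc n)) = refl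

theorem2p1 : ∀ n → u n ≡ scale (+ 2) (shift 2 ((qPoch 2 ^ˢ 2) ⊛ (qPoch 8 ^ˢ 2) ⊛ (qPoch 32 ^ˢ 2) ⊛ qPochInv 1 ⊛ (qPochInv 4 ^ˢ 5) ⊛ qPochInv 16)) n
-- The signed count is 2t - p, and p - (2t - p) is 2u; one factor 2 of the resulting 4 therefore
-- cancels.
theorem2p1 n = trans (ℤₚ.*-cancelˡ-≡ (+ 2) (u n) (+ 2 ℤ.* r) (begin
  + 2 ℤ.* u n                                              ≡⟨ double-u (+ p n) (+ t n) ⟩
  + p n ℤ.- ((+ t n ℤ.+ + t n) ℤ.- + p n)                  ≡⟨ P-F-coefficient n (ℕₚ.n<1+n n) ⟩
  (r ℤ.+ r) ℤ.+ (r ℤ.+ r)                                  ≡⟨ quadruple r ⟩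
  + 2 ℤ.* (+ 2 ℤ.* r)                                      ∎))
  (cong (λ z → + 2 ℤ.* z) (sym (shift-delay quotient n)))
  where
  -- Modulo qⁿ⁺¹ the coefficient of qⁿ is still visible.
  open Coefficients (suc n)
  open ≡-Reasoning
  r = delay 2 quotient n
  double-u : ∀ p t → + 2 ℤ.* (p ℤ.- t) ≡ p ℤ.- ((t ℤ.+ t) ℤ.- p)
  double-u = ℤ-Solver.solve-∀
  quadruple : ∀ r → (r ℤ.+ r) ℤ.+ (r ℤ.+ r) ≡ + 2 ℤ.* (+ 2 ℤ.* r)
  quadruple = ℤ-Solver.solve-∀
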